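{- The Kostka-Foulkes polynomials $K^{D_n}_{\lambda,\mu}(q)$ for the root system $D_n$, for partitions $\lambda$ (with nonnegative last part) with $2\le|\lambda|\le3$ and $\mu$ with $|\mu|\le2$, are as follows (partitions are completed by zeros to length $n$; $\emptyset$ denotes the zero weight). $\lambda=(3)$: $K_{(3),(2)}=K_{(3),(1,1)}=K_{(3),\emptyset}=0$; $K_{(3),(1)}=q^2\,\frac{q^{2n-2}-1}{q^2-1}$. $\lambda=(2,1)$: $K_{(2,1),(2)}=K_{(2,1),(1,1)}=K_{(2,1),\emptyset}=0$; $K_{(2,1),(1)}=q^{n-1}+q\,\frac{q^{2n-3}-1}{q-1}$. $\lambda=(1,1,1)$: $K_{(1,1,1),(2)}=K_{(1,1,1),(1,1)}=K_{(1,1,1),\emptyset}=0$; $K_{(1,1,1),(1)}=q^{n-2}+q\,\frac{q^{2n-4}-1}{q^2-1}$. $\lambda=(2)$: $K_{(2),(2)}=1$; $K_{(2),(1,1)}=q$; $K_{(2),(1)}=0$; $K_{(2),\emptyset}=q^2\,\frac{q^{2n-2}-1}{q^2-1}$. $\lambda=(1,1)$: $K_{(1,1),(2)}=0$; $K_{(1,1),(1,1)}=1$; $K_{(1,1),(1)}=0$; $K_{(1,1),\emptyset}=q^{n-1}+q\,\frac{q^{2n-2}-1}{q^2-1}$.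
   Context: Write $\beta=(\beta_{\overline n},\dots,\beta_{\overline 1})$ for $\sum_i\beta_{\overline i}\varepsilon_{\overline i}$, $(\varepsilon_{\overline i})$ an orthonormal basis of $\mathbb R^n$; a partition $(\lambda_1\ge\lambda_2\ge\cdots)$ with at most $n$ parts is the dominant weight with $\lambda_{\overline n}=\lambda_1,\lambda_{\overline{n-1}}=\lambda_2,\dots$, and $|\lambda|$ is the sum of its parts. For type $D_n$ ($so_{2n}$) the positive roots are $\varepsilon_{\overline i}\pm\varepsilon_{\overline j}$ ($1\le j<i\le n$), $\rho=(n-1,n-2,\dots,0)$ is their half sum, and $W$ is the group of signed permutations of the coordinates with an even number of sign changes, with length $l$. The $q$-partition function is defined by $\prod_{\alpha\in R^+}\frac1{1-qx^\alpha}=\sum_\beta\mathcal P_q(\beta)x^\beta$, where $R^+$ is the set of positive roots ($\mathcal P_q(\beta)=0$ if $\beta$ is not a nonnegative integral combination of positive roots), and $K_{\lambda,\mu}(q)=\sum_{\sigma\in W}(-1)^{l(\sigma)}\mathcal P_q(\sigma(\lambda+\rho)-(\mu+\rho))$.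
   Formalization: Proved for n ≥ 2 (n ≥ 3 for λ=(1,1,1)), except that K_{(2,1),(1)} and K_{(1,1),∅} need n ≥ 3 and K_{(1,1,1),(1)} needs n ≥ 4: at n=2, resp. n=3, the true value is q while the stated formula gives 2q. -}

module Defs where

open import Data.Nat as ℕ using (ℕ; zero; suc; _∸_)
open import Data.Nat.Divisibility using (_∣?_)
open import Data.Integer as ℤ using (ℤ; +_; 0ℤ; 1ℤ; -1ℤ)
open import Data.Sign as Sign using (Sign)
open import Data.Fin as Fin using (Fin; toℕ; punchIn)
open import Data.Vec as Vec using (Vec; []; _∷_)
import Data.Vec.Properties as Vec
open import Data.List as List using (List; []; _∷_; concatMap; cartesianProduct; allFin; upTo)
import Data.List.Membership.DecPropositional as DecMembership
open import Data.Bool using (if_then_else_)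
open import Data.Product using (_×_; _,_; proj₁; map₂)
open import Relation.Binary using (DecidableEquality)
open import Relation.Nullary.Decidable using (does)

sumℤ : List ℤ → ℤ
sumℤ = List.foldr ℤ._+_ 0ℤ

-- Polynomials in q are represented in ℤ[[q]] ⊇ ℤ[q]: F k is the coefficient
-- of q^k, and equality is pointwise equality _≗_.
Series : Set
Series = ℕ → ℤ

infix  9 q^_
infixl 7 _⊛_
infixl 6 _⊖_

q^_ : ℕ → Series
(q^ m) k = if does (k ℕ.≟ m) then 1ℤ else 0ℤ

𝟘 𝟙 : Series
𝟘 _ = 0ℤ
𝟙 = q^ 0

_⊖_ : Series → Series → Series
(F ⊖ G) k = F k ℤ.- G k

_⊛_ : Series → Series → Series
(F ⊛ G) k = sumℤ (List.map (λ i → F i ℤ.* G (k ∸ i)) (upTo (suc k)))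

-- Coordinates are listed as (β_n̄ , … , β_1̄): position p : Fin n carries the
-- index n - p, so a larger index means an earlier position.
Weight : ℕ → Set
Weight n = Vec ℤ n

infixl 6 _⊞_ _⊟_

_⊞_ _⊟_ : ∀ {n} → Weight n → Weight n → Weight n
_⊞_ = Vec.zipWith ℤ._+_
_⊟_ = Vec.zipWith ℤ._-_

neg : ∀ {n} → Weight n → Weight n
neg = Vec.map (λ a → ℤ.- a)

0ʷ : ∀ {n} → Weight n
0ʷ = Vec.replicate _ 0ℤ

_≟ʷ_ : ∀ {n} → DecidableEquality (Weight n)
_≟ʷ_ = Vec.≡-dec ℤ._≟_

ε : ∀ {n} → Fin n → Weight n
ε p = Vec.tabulate (λ r → if does (r Fin.≟ p) then 1ℤ else 0ℤ)

-- The dominant weight of a partition, given by its nonzero parts and completed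
-- by zeros to length n. (Parts beyond the n-th are dropped, so this is only
-- meaningful for partitions with at most n parts.)
weight : ∀ n → List ℕ → Weight n
weight zero    _        = []
weight (suc n) []       = 0ℤ ∷ weight n []
weight (suc n) (a ∷ as) = + a ∷ weight n as

positiveRoots : ∀ n → List (Weight n)
positiveRoots n =
  concatMap (λ (p , r) → (ε p ⊞ ε r) ∷ (ε p ⊟ ε r) ∷ [])
    (List.filter (λ (p , r) → p Fin.<? r) (cartesianProduct (allFin n) (allFin n)))

ρ : ∀ n → Weight n
ρ n = Vec.tabulate (λ p → + (n ∸ suc (toℕ p)))

-- The entry (s , r) of σ at position p means (σ β)_p = s β_r. This is a signed
-- permutation exactly when the second components are pairwise distinct.
SignedMap : ℕ → Set
SignedMap n = Vec (Sign × Fin n) n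

infixr 8 _∙_

_∙_ : ∀ {n} → SignedMap n → Weight n → Weight n
σ ∙ β = Vec.map (λ (s , r) → (s ℤ.◃ 1) ℤ.* Vec.lookup β r) σ

-- Choose the first entry freely; the others form a signed permutation of the
-- remaining n positions. Every signed permutation is listed exactly once.
signedPermutations : ∀ n → List (SignedMap n)
signedPermutations zero    = [] ∷ []
signedPermutations (suc n) =
  concatMap (λ (s , r) → List.map (λ σ → (s , r) ∷ Vec.map (map₂ (punchIn r)) σ)
                                  (signedPermutations n))
    (cartesianProduct (Sign.+ ∷ Sign.- ∷ []) (allFin (suc n)))

signChanges : ∀ {n} → SignedMap n → ℕ
signChanges = Vec.count (λ e → proj₁ e Sign.≟ Sign.-)

W : ∀ n → List (SignedMap n)
W n = List.filter (λ σ → 2 ∣? signChanges σ) (signedPermutations n)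

-- The length of σ ∈ W, as the number of positive roots σ makes negative.
l : ∀ {n} → SignedMap n → ℕ
l {n} σ = List.length (List.filter (λ α → neg (σ ∙ α) ∈? positiveRoots n) (positiveRoots n))
  where open DecMembership _≟ʷ_ using (_∈?_)

-- F β k is the coefficient of q^k x^β. In each q-degree only finitely many x^β
-- occur in the expansions below.
FormalSum : ℕ → Set
FormalSum n = Weight n → Series

one : ∀ {n} → FormalSum n
one β = if does (β ≟ʷ 0ʷ) then 𝟙 else 𝟘

-- The product G of F with 1/(1 - q x^α) = Σ_j q^j x^(jα), computed
-- from G = F + q x^α G.
_÷⟨1-qx^_⟩ : ∀ {n} → FormalSum n → Weight n → FormalSum n
(F ÷⟨1-qx^ α ⟩) β zero    = F β zero
(F ÷⟨1-qx^ α ⟩) β (suc k) = F β (suc k) ℤ.+ (F ÷⟨1-qx^ α ⟩) (β ⊟ α) k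

𝒫 : ∀ {n} → FormalSum n
𝒫 {n} = List.foldr (λ α F → F ÷⟨1-qx^ α ⟩) one (positiveRoots n)

K : ∀ {n} → Weight n → Weight n → Series
K {n} lam mu k =
  sumℤ (List.map (λ σ → (-1ℤ ℤ.^ l σ) ℤ.* 𝒫 (σ ∙ (lam ⊞ ρ n) ⊟ (mu ⊞ ρ n)) k) (W n))

{-# OPTIONS --safe #-}

-- Grouping the signed permutations by the image of the first coordinate and the
-- positive roots by whether they involve it turns K in rank n + 1 into a sum in
-- rank n: a root ε₁ ± ε_j lowers the first coordinate by one, so if the first
-- coordinates of λ + ρ and μ + ρ differ by k only the k-th complete symmetric
-- function of the weights ±ε_j enters, and only k ≤ 2 occurs here. As the sum
-- over W is alternating in λ + ρ, adding ±ε_j or ±2ε_j to ρ mostly produces two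
-- coordinates equal up to sign, hence 0. What survives is the recursion
--   A(n+1) = q² (A(n) + 1),   B(n+1) = q (A(n) + 1 + B(n)) - A(n)
-- for A = K_{(2),∅} and B = K_{(1,1),∅}, to which the other entries reduce. The
-- entries with |λ| - |μ| odd vanish because roots have even coordinate sum.

module Submission where

open import Defs
open import Data.Bool using (true; false; if_then_else_)
open import Data.Fin as Fin using (Fin; toℕ; punchIn)
open import Data.Integer as ℤ using (ℤ; +_; -[1+_]; 0ℤ; 1ℤ; -1ℤ; _+_; _*_; -_; _-_; _◃_)
open import Data.Integer.Divisibility.Signed as ∣ using (_∣_; divides; _∣?_)
import Data.Integer.Properties as ℤ
open import Data.Integer.Tactic.RingSolver using (solve-∀)
open import Data.List as List using (List; []; _∷_; _++_; concatMap; cartesianProduct; allFin; upTo; filter; length)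
import Data.List.Membership.DecPropositional as DecMembership
open import Data.List.Membership.Propositional using (_∈_)
open import Data.List.Membership.Propositional.Properties using (∈-++⁺ˡ; ∈-++⁺ʳ; ∈-map⁺)
import Data.List.Properties as List
open import Data.List.Relation.Unary.All as All using (All; []; _∷_)
import Data.List.Relation.Unary.All.Properties as All
open import Data.List.Relation.Unary.Any using (here; there)
open import Data.Nat as ℕ using (ℕ; zero; suc; _≤_; _∸_; s≤s; z≤n)
import Data.Nat.Divisibility as ℕ∣
open import Data.Nat.ListAction using (sum)
import Data.Nat.Properties as ℕ
open import Data.Product using (_×_; _,_; proj₁; proj₂; map₂)
open import Data.Sign as Sign using (Sign)
open import Data.Sum using (_⊎_; inj₁; inj₂)
open import Data.Vec as Vec using (Vec; []; _∷_; lookup; insertAt; removeAt)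
import Data.Vec.Properties as Vec
open import Data.Vec.Relation.Unary.All as VAll using ([]; _∷_)
open import Function using (_∘_; id)
open import Function.Bundles using (mk⇔)
open import Relation.Binary.PropositionalEquality
open import Relation.Nullary using (Dec; ¬_; does)
open import Relation.Nullary.Decidable using (dec-true; dec-false; does-⇔; from-no)
open import Relation.Unary using (Decidable)

-- Positive roots by recursion on the rank

-- Behind the recursion is the tensor square of the vector representation V. Acting on alternating
-- functions of λ + ρ, the power sums p₁ and p₂ of the weights ±ε_j send ρ to V and to Sym²V - Λ²V,
-- and p₁² sends it to V ⊗ V = V(2) + 1 + Λ²V, where V(2) has highest weight (2). As p₁² + p₂ = 2h₂,
-- the exterior square cancels in h₂ and V(2) + 1 remains: this is the term A(n) + 1. The complete
-- symmetric function h₂ moves pairs of coordinates at once, whereas p₁ and p₂ translate a single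
-- one; hence everything is computed for 2h₂ and halved at the end. Two features of type D cause the
-- bookkeeping. Removing a coordinate together with a sign change leads from W to its other coset in
-- the group of all signed permutations, so alternating sums come in pairs indexed by a parity. And
-- in small rank further terms survive, notably the weight (1,-1) in rank 2, where Λ²V splits.

units : ∀ n → List (Weight n)
units zero    = []
units (suc n) = (1ℤ ∷ 0ʷ) ∷ (-1ℤ ∷ 0ʷ) ∷ List.map (0ℤ ∷_) (units n)

roots : ∀ n → List (Weight n)
roots zero    = []
roots (suc n) = List.map (1ℤ ∷_) (units n) ++ List.map (0ℤ ∷_) (roots n)

⊞-identityˡ : ∀ {n} (β : Weight n) → 0ʷ ⊞ β ≡ β
⊞-identityˡ = Vec.zipWith-identityˡ ℤ.+-identityˡ

⊟-identityʳ : ∀ {n} (β : Weight n) → β ⊟ 0ʷ ≡ β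
⊟-identityʳ []      = refl
⊟-identityʳ (b ∷ β) = cong₂ _∷_ (ℤ.+-identityʳ b) (⊟-identityʳ β)

0⊟ : ∀ {n} (β : Weight n) → 0ʷ ⊟ β ≡ neg β
0⊟ []      = refl
0⊟ (b ∷ β) = cong₂ _∷_ (ℤ.+-identityˡ (- b)) (0⊟ β)

tabulate-0 : ∀ n → Vec.tabulate {n = n} (λ _ → 0ℤ) ≡ 0ʷ
tabulate-0 zero    = refl
tabulate-0 (suc n) = cong (0ℤ ∷_) (tabulate-0 n)

neg-0ʷ : ∀ n → neg (0ʷ {n}) ≡ 0ʷ
neg-0ʷ zero    = refl
neg-0ʷ (suc n) = cong (0ℤ ∷_) (neg-0ʷ n)

ε-zero : ∀ {n} → ε {suc n} Fin.zero ≡ 1ℤ ∷ 0ʷ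
ε-zero {n} = cong (1ℤ ∷_) (tabulate-0 n)

allFin-suc : ∀ n → allFin (suc n) ≡ Fin.zero ∷ List.map Fin.suc (allFin n)
allFin-suc n = cong (Fin.zero ∷_) (sym (List.map-tabulate id Fin.suc))

±ε : ∀ {n} → Fin n → List (Weight n)
±ε j = ε j ∷ neg (ε j) ∷ []

concatMap-map-commute : ∀ {A A′ B B′ : Set} {f : A′ → List B′} {g : A → List B} {h : A → A′} {h′ : B → B′} →
  (∀ a → f (h a) ≡ List.map h′ (g a)) → ∀ xs → concatMap f (List.map h xs) ≡ List.map h′ (concatMap g xs)
concatMap-map-commute              eq []       = refl
concatMap-map-commute {g = g} {h′ = h′} eq (x ∷ xs) =
  trans (cong₂ _++_ (eq x) (concatMap-map-commute eq xs)) (sym (List.map-++ h′ (g x) (concatMap g xs)))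

units≡ : ∀ n → concatMap ±ε (allFin n) ≡ units n
units≡ zero    = refl
units≡ (suc n) = trans (cong (concatMap ±ε) (allFin-suc n))
  (cong₂ _∷_ (ε-zero {n}) (cong₂ _∷_ (trans (cong neg (ε-zero {n})) (cong (-1ℤ ∷_) (neg-0ʷ n)))
    (trans (concatMap-map-commute (λ _ → refl) (allFin n)) (cong (List.map (0ℤ ∷_)) (units≡ n)))))

Pair : ℕ → Set
Pair n = Fin n × Fin n

ordered? : ∀ {n} (pr : Pair n) → Dec (proj₁ pr Fin.< proj₂ pr)
ordered? (p , r) = p Fin.<? r

pairRoots : ∀ {n} → Pair n → List (Weight n)
pairRoots (p , r) = (ε p ⊞ ε r) ∷ (ε p ⊟ ε r) ∷ []

sucPair : ∀ {n} → Pair n → Pair (suc n)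
sucPair (p , r) = Fin.suc p , Fin.suc r

filter-row : ∀ {n} (p : Fin n) rs →
  filter ordered? (List.map (Fin.suc p ,_) (List.map Fin.suc rs)) ≡
  List.map sucPair (filter ordered? (List.map (p ,_) rs))
filter-row p []       = refl
filter-row p (r ∷ rs) with does (p Fin.<? r)
... | true  = cong (_ ∷_) (filter-row p rs)
... | false = filter-row p rs

filter-rows : ∀ {n} (ps rs : List (Fin n)) →
  filter ordered? (cartesianProduct (List.map Fin.suc ps) (Fin.zero ∷ List.map Fin.suc rs)) ≡
  List.map sucPair (filter ordered? (cartesianProduct ps rs))
filter-rows []       rs = refl
filter-rows (p ∷ ps) rs = begin
  filter ordered? (row ++ rest)                     ≡⟨ List.filter-++ ordered? row rest ⟩
  filter ordered? row ++ filter ordered? rest       ≡⟨ cong₂ _++_ (filter-row p rs) (filter-rows ps rs) ⟩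
  List.map sucPair (filter ordered? row′) ++ List.map sucPair (filter ordered? rest′)
                                                    ≡⟨ List.map-++ sucPair (filter ordered? row′) _ ⟨
  List.map sucPair (filter ordered? row′ ++ filter ordered? rest′)
                                                    ≡⟨ cong (List.map sucPair) (List.filter-++ ordered? row′ rest′) ⟨
  List.map sucPair (filter ordered? (row′ ++ rest′)) ∎
  where
  open ≡-Reasoning
  row   = List.map (Fin.suc p ,_) (List.map Fin.suc rs)
  rest  = cartesianProduct (List.map Fin.suc ps) (Fin.zero ∷ List.map Fin.suc rs)
  row′  = List.map (p ,_) rs
  rest′ = cartesianProduct ps rs

filter-first-row : ∀ {n} (rs : List (Fin n)) →
  filter ordered? (List.map (Fin.zero ,_) (List.map Fin.suc rs)) ≡ List.map (Fin.zero ,_) (List.map Fin.suc rs)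
filter-first-row []       = refl
filter-first-row (r ∷ rs) = cong (_ ∷_) (filter-first-row rs)

-- The two lists agree even in their order, so a single rewriting transfers both folds over the
-- positive roots, the one in `𝒫` and the one in `l`.
positiveRoots≡roots : ∀ n → positiveRoots n ≡ roots n
positiveRoots≡roots zero    = refl
positiveRoots≡roots (suc n) = begin
  concatMap pairRoots (filter ordered? (cartesianProduct (allFin (suc n)) (allFin (suc n))))
    ≡⟨ cong (λ ps → concatMap pairRoots (filter ordered? (cartesianProduct ps ps))) (allFin-suc n) ⟩
  concatMap pairRoots (filter ordered? (row ++ rest))
    ≡⟨ cong (concatMap pairRoots) (List.filter-++ ordered? row rest) ⟩
  concatMap pairRoots (filter ordered? row ++ filter ordered? rest)
    ≡⟨ cong₂ (λ ps qs → concatMap pairRoots (ps ++ qs)) (filter-first-row (allFin n)) (filter-rows (allFin n) (allFin n)) ⟩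
  concatMap pairRoots (row ++ List.map sucPair pairs)
    ≡⟨ List.concatMap-++ pairRoots row _ ⟩
  concatMap pairRoots row ++ concatMap pairRoots (List.map sucPair pairs)
    ≡⟨ cong₂ _++_ (trans (cong (concatMap pairRoots) (sym (List.map-∘ (allFin n))))
                    (trans (concatMap-map-commute first (allFin n)) (cong (List.map (1ℤ ∷_)) (units≡ n))))
                  (trans (concatMap-map-commute (λ _ → refl) pairs) (cong (List.map (0ℤ ∷_)) (positiveRoots≡roots n))) ⟩
  roots (suc n) ∎
  where
  open ≡-Reasoning
  row   = List.map (Fin.zero ,_) (List.map Fin.suc (allFin n))
  rest  = cartesianProduct (List.map Fin.suc (allFin n)) (Fin.zero ∷ List.map Fin.suc (allFin n))
  pairs = filter ordered? (cartesianProduct (allFin n) (allFin n))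
  first : ∀ j → pairRoots {suc n} (Fin.zero , Fin.suc j) ≡ List.map (1ℤ ∷_) (±ε j)
  first j = cong₂ (λ α α′ → (1ℤ ∷ α) ∷ (1ℤ ∷ α′) ∷ [])
    (trans (cong (_⊞ ε j) (tabulate-0 n)) (⊞-identityˡ (ε j)))
    (trans (cong (_⊟ ε j) (tabulate-0 n)) (0⊟ (ε j)))

-- Signed permutations preserve the root system

data Is±1 : ℤ → Set where
  +1 : Is±1 1ℤ
  −1 : Is±1 -1ℤ

data IsUnit : ∀ {n} → Weight n → Set where
  here  : ∀ {n a} {w : Weight n} → Is±1 a → w ≡ 0ʷ → IsUnit (a ∷ w)
  there : ∀ {n} {w : Weight n} → IsUnit w → IsUnit (0ℤ ∷ w)

-- Roots of either sign: unlike membership in `roots`, this is stable under signed permutations.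
data IsRoot : ∀ {n} → Weight n → Set where
  here  : ∀ {n a} {w : Weight n} → Is±1 a → IsUnit w → IsRoot (a ∷ w)
  there : ∀ {n} {α : Weight n} → IsRoot α → IsRoot (0ℤ ∷ α)

units-areUnits : ∀ n → All IsUnit (units n)
units-areUnits zero    = []
units-areUnits (suc n) = here +1 refl ∷ here −1 refl ∷ All.map⁺ (All.map there (units-areUnits n))

roots-areRoots : ∀ n → All IsRoot (roots n)
roots-areRoots zero    = []
roots-areRoots (suc n) =
  All.++⁺ (All.map⁺ (All.map (here +1) (units-areUnits n))) (All.map⁺ (All.map there (roots-areRoots n)))

lookup-0ʷ : ∀ {n} (r : Fin n) → lookup 0ʷ r ≡ 0ℤ
lookup-0ʷ r = Vec.lookup-replicate r 0ℤ

removeAt-0ʷ : ∀ {n} (r : Fin (suc n)) → removeAt 0ʷ r ≡ 0ʷ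
removeAt-0ʷ         Fin.zero    = refl
removeAt-0ʷ {suc n} (Fin.suc r) = cong (0ℤ ∷_) (removeAt-0ʷ r)

insertAt-0ʷ : ∀ {n} (r : Fin (suc n)) → insertAt 0ʷ r 0ℤ ≡ 0ʷ
insertAt-0ʷ         Fin.zero    = refl
insertAt-0ʷ {suc n} (Fin.suc r) = cong (0ℤ ∷_) (insertAt-0ʷ r)

lookup-punchIn : ∀ {n} (β : Weight (suc n)) r i → lookup β (punchIn r i) ≡ lookup (removeAt β r) i
lookup-punchIn (b ∷ β)     Fin.zero    i           = refl
lookup-punchIn (b ∷ c ∷ β) (Fin.suc r) Fin.zero    = refl
lookup-punchIn (b ∷ c ∷ β) (Fin.suc r) (Fin.suc i) = lookup-punchIn (c ∷ β) r i

unit-removeAt : ∀ {n} {w : Weight (suc n)} → IsUnit w → ∀ r →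
  (lookup w r ≡ 0ℤ × IsUnit (removeAt w r)) ⊎ (Is±1 (lookup w r) × removeAt w r ≡ 0ʷ)
unit-removeAt         (here ±1 refl) Fin.zero    = inj₂ (±1 , refl)
unit-removeAt {suc n} (here ±1 refl) (Fin.suc r) = inj₁ (lookup-0ʷ r , here ±1 (removeAt-0ʷ r))
unit-removeAt         (there u)      Fin.zero    = inj₁ (refl , u)
unit-removeAt {suc n} (there {w = _ ∷ _} u) (Fin.suc r) with unit-removeAt u r
... | inj₁ (eq , u′) = inj₁ (eq , there u′)
... | inj₂ (±1 , eq) = inj₂ (±1 , cong (0ℤ ∷_) eq)

root-removeAt : ∀ {n} {α : Weight (suc n)} → IsRoot α → ∀ r →
  (lookup α r ≡ 0ℤ × IsRoot (removeAt α r)) ⊎ (Is±1 (lookup α r) × IsUnit (removeAt α r))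
root-removeAt         (here ±1 u) Fin.zero    = inj₂ (±1 , u)
root-removeAt {suc n} (here {w = _ ∷ _} ±1 u) (Fin.suc r) with unit-removeAt u r
... | inj₁ (eq , u′) = inj₁ (eq , here ±1 u′)
... | inj₂ (±1′ , eq) = inj₂ (±1′ , here ±1 eq)
root-removeAt         (there p)   Fin.zero    = inj₁ (refl , p)
root-removeAt {suc n} (there {α = _ ∷ _} p) (Fin.suc r) with root-removeAt p r
... | inj₁ (eq , p′) = inj₁ (eq , there p′)
... | inj₂ (±1 , u)  = inj₂ (±1 , there u)

prepend : ∀ {n} → Sign → Fin (suc n) → SignedMap n → SignedMap (suc n)
prepend s r σ = (s , r) ∷ Vec.map (map₂ (punchIn r)) σ

-- A `SignedMap` may repeat positions, and its tail still refers to the positions of the larger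
-- rank. This view mirrors the enumeration `signedPermutations` and makes induction on the rank
-- possible.
data IsSignedPermutation : ∀ {n} → SignedMap n → Set where
  []  : IsSignedPermutation []
  _∷_ : ∀ {n} {σ : SignedMap n} ((s , r) : Sign × Fin (suc n)) →
        IsSignedPermutation σ → IsSignedPermutation (prepend s r σ)

prepend-∙ : ∀ {n} s r (σ : SignedMap n) β → prepend s r σ ∙ β ≡ (s ◃ 1) * lookup β r ∷ σ ∙ removeAt β r
prepend-∙ s r σ β = cong (_ ∷_) (trans (sym (Vec.map-∘ _ _ σ))
  (Vec.map-cong (λ (s′ , i) → cong ((s′ ◃ 1) *_) (lookup-punchIn β r i)) σ))

◃-±1 : ∀ s {a} → Is±1 a → Is±1 ((s ◃ 1) * a)
◃-±1 Sign.+ +1 = +1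
◃-±1 Sign.+ −1 = −1
◃-±1 Sign.- +1 = −1
◃-±1 Sign.- −1 = +1

∙-0ʷ : ∀ {n} {σ : SignedMap n} → IsSignedPermutation σ → σ ∙ 0ʷ ≡ 0ʷ
∙-0ʷ []                        = refl
∙-0ʷ {σ = σ′} (_∷_ {σ = σ} (s , r) p) = begin
  prepend s r σ ∙ 0ʷ                           ≡⟨ prepend-∙ s r σ 0ʷ ⟩
  (s ◃ 1) * lookup 0ʷ r ∷ σ ∙ removeAt 0ʷ r    ≡⟨ cong₂ (λ a β → (s ◃ 1) * a ∷ σ ∙ β) (lookup-0ʷ r) (removeAt-0ʷ r) ⟩
  (s ◃ 1) * 0ℤ ∷ σ ∙ 0ʷ                        ≡⟨ cong₂ _∷_ (ℤ.*-zeroʳ (s ◃ 1)) (∙-0ʷ p) ⟩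
  0ʷ                                           ∎
  where open ≡-Reasoning

∙-unit : ∀ {n} {σ : SignedMap n} {w} → IsSignedPermutation σ → IsUnit w → IsUnit (σ ∙ w)
∙-unit []            ()
∙-unit {w = w} (_∷_ {σ = σ} (s , r) p) u = subst IsUnit (sym (prepend-∙ s r σ w)) (lemma (unit-removeAt u r))
  where
  lemma : (lookup w r ≡ 0ℤ × IsUnit (removeAt w r)) ⊎ (Is±1 (lookup w r) × removeAt w r ≡ 0ʷ) →
          IsUnit ((s ◃ 1) * lookup w r ∷ σ ∙ removeAt w r)
  lemma (inj₁ (eq , u′)) rewrite eq | ℤ.*-zeroʳ (s ◃ 1) = there (∙-unit p u′)
  lemma (inj₂ (±1 , eq)) rewrite eq = here (◃-±1 s ±1) (∙-0ʷ p)

∙-root : ∀ {n} {σ : SignedMap n} {α} → IsSignedPermutation σ → IsRoot α → IsRoot (σ ∙ α)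
∙-root []            ()
∙-root {α = α} (_∷_ {σ = σ} (s , r) p) u = subst IsRoot (sym (prepend-∙ s r σ α)) (lemma (root-removeAt u r))
  where
  lemma : (lookup α r ≡ 0ℤ × IsRoot (removeAt α r)) ⊎ (Is±1 (lookup α r) × IsUnit (removeAt α r)) →
          IsRoot ((s ◃ 1) * lookup α r ∷ σ ∙ removeAt α r)
  lemma (inj₁ (eq , p′)) rewrite eq | ℤ.*-zeroʳ (s ◃ 1) = there (∙-root p p′)
  lemma (inj₂ (±1 , u′)) = here (◃-±1 s ±1) (∙-unit p u′)

-- The sign of a signed permutation as a product over the positive roots

leading : ∀ {n} → Weight n → ℤ
-- A default: a root has a nonzero coordinate, so its sign is decided by one of the other clauses.
leading []               = 1ℤ
leading (+ zero    ∷ β)  = leading β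
leading (+ suc _   ∷ β)  = 1ℤ
leading (-[1+ _ ]  ∷ β)  = -1ℤ

neg-unit : ∀ {n} {w : Weight n} → IsUnit w → IsUnit (neg w)
neg-unit {suc n} (here +1 refl) = here −1 (neg-0ʷ n)
neg-unit {suc n} (here −1 refl) = here +1 (neg-0ʷ n)
neg-unit         (there u)      = there (neg-unit u)

leading-neg : ∀ {n} {α : Weight n} → IsRoot α → leading (neg α) ≡ - leading α
leading-neg (here +1 u) = refl
leading-neg (here −1 u) = refl
leading-neg (there p)   = leading-neg p

units-complete : ∀ {n} {w : Weight n} → IsUnit w → w ∈ units n
units-complete (here +1 refl) = here refl
units-complete (here −1 refl) = there (here refl)
units-complete (there u)      = there (there (∈-map⁺ _ (units-complete u)))

leading-roots : ∀ n → All (λ α → leading α ≡ 1ℤ) (roots n)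
leading-roots zero    = []
leading-roots (suc n) =
  All.++⁺ (All.map⁺ (All.map (λ _ → refl) (units-areUnits n))) (All.map⁺ (leading-roots n))

root-sign : ∀ {n} {α : Weight n} → IsRoot α → leading α ≡ 1ℤ ⊎ (leading α ≡ -1ℤ × neg α ∈ roots n)
root-sign (here +1 u) = inj₁ refl
root-sign (here −1 u) = inj₂ (refl , ∈-++⁺ˡ (∈-map⁺ _ (units-complete (neg-unit u))))
root-sign {suc n} (there p)   with root-sign p
... | inj₁ eq         = inj₁ eq
... | inj₂ (eq , mem) = inj₂ (eq , ∈-++⁺ʳ (List.map (1ℤ ∷_) (units n)) (∈-map⁺ _ mem))

module _ {n : ℕ} where
  open DecMembership (_≟ʷ_ {n}) public using (_∈?_)

±_ : ∀ {P : Set} → Dec P → ℤ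
± d = if does d then -1ℤ else 1ℤ

1≢-1 : ¬ (1ℤ ≡ -1ℤ)
1≢-1 ()

negated-sign : ∀ {n} {α : Weight n} → IsRoot α → ± (neg α ∈? roots n) ≡ leading α
negated-sign {n} {α} p with root-sign p
... | inj₂ (eq , mem) rewrite dec-true (neg α ∈? roots n) mem = sym eq
... | inj₁ eq rewrite dec-false (neg α ∈? roots n)
    (λ mem → 1≢-1 (trans (sym (All.lookup (leading-roots n) mem)) (trans (leading-neg p) (cong -_ eq)))) = sym eq

∏ : ∀ {A : Set} → (A → ℤ) → List A → ℤ
∏ f []       = 1ℤ
∏ f (x ∷ xs) = f x * ∏ f xs

∏-++ : ∀ {A : Set} (f : A → ℤ) xs ys → ∏ f (xs ++ ys) ≡ ∏ f xs * ∏ f ys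
∏-++ f []       ys = sym (ℤ.*-identityˡ _)
∏-++ f (x ∷ xs) ys = trans (cong (f x *_) (∏-++ f xs ys)) (sym (ℤ.*-assoc (f x) _ _))

∏-map : ∀ {A B : Set} (f : B → ℤ) (g : A → B) xs → ∏ f (List.map g xs) ≡ ∏ (f ∘ g) xs
∏-map f g []       = refl
∏-map f g (x ∷ xs) = cong (f (g x) *_) (∏-map f g xs)

∏-cong : ∀ {A : Set} {f g : A → ℤ} {xs} → All (λ x → f x ≡ g x) xs → ∏ f xs ≡ ∏ g xs
∏-cong []         = refl
∏-cong (eq ∷ eqs) = cong₂ _*_ eq (∏-cong eqs)

length-filter-sign : ∀ {A : Set} {P : A → Set} (P? : Decidable P) xs →
  -1ℤ ℤ.^ length (filter P? xs) ≡ ∏ (λ x → ± (P? x)) xs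
length-filter-sign P? []       = refl
length-filter-sign P? (x ∷ xs) with does (P? x)
... | true  = cong (-1ℤ *_) (length-filter-sign P? xs)
... | false = trans (length-filter-sign P? xs) (sym (ℤ.*-identityˡ _))

-- Each positive root contributes -1 exactly when `σ` makes it negative, so this is (-1)^l(σ). As a
-- product it can be split along the roots through one coordinate.
sgn : ∀ {n} → SignedMap n → ℤ
sgn {n} σ = ∏ (λ α → leading (σ ∙ α)) (roots n)

length-sgn : ∀ {n} {σ : SignedMap n} → IsSignedPermutation σ → -1ℤ ℤ.^ l σ ≡ sgn σ
length-sgn {n} {σ} p = lemma (positiveRoots≡roots n)
  where
  lemma : ∀ {R} → R ≡ roots n → -1ℤ ℤ.^ length (filter (λ α → neg (σ ∙ α) ∈? R) R) ≡ sgn σ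
  lemma refl = trans (length-filter-sign (λ α → neg (σ ∙ α) ∈? roots n) (roots n))
    (∏-cong (All.map (λ q → negated-sign (∙-root p q)) (roots-areRoots n)))

∏-units-split : ∀ {n} (F : Weight (suc n) → ℤ) (r : Fin (suc n)) →
  ∏ F (units (suc n)) ≡
  F (insertAt 0ʷ r 1ℤ) * F (insertAt 0ʷ r -1ℤ) * ∏ (λ w → F (insertAt w r 0ℤ)) (units n)
∏-units-split {n} F Fin.zero = begin
  F (1ℤ ∷ 0ʷ) * (F (-1ℤ ∷ 0ʷ) * ∏ F (List.map (0ℤ ∷_) (units n)))
    ≡⟨ ℤ.*-assoc (F (1ℤ ∷ 0ʷ)) _ _ ⟨
  F (1ℤ ∷ 0ʷ) * F (-1ℤ ∷ 0ʷ) * ∏ F (List.map (0ℤ ∷_) (units n))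
    ≡⟨ cong (F (1ℤ ∷ 0ʷ) * F (-1ℤ ∷ 0ʷ) *_) (∏-map F (0ℤ ∷_) (units n)) ⟩
  F (1ℤ ∷ 0ʷ) * F (-1ℤ ∷ 0ʷ) * ∏ (λ w → F (0ℤ ∷ w)) (units n) ∎
  where open ≡-Reasoning
∏-units-split {suc n} F (Fin.suc r) = begin
  a * (b * ∏ F (List.map (0ℤ ∷_) (units (suc n))))
    ≡⟨ cong (λ z → a * (b * z)) (trans (∏-map F (0ℤ ∷_) (units (suc n))) (∏-units-split (F ∘ (0ℤ ∷_)) r)) ⟩
  a * (b * (c * d * e))
    ≡⟨ swap a b c d e ⟩
  c * d * (a * (b * e))
    ≡⟨ cong₂ (λ α α′ → c * d * (F (1ℤ ∷ α) * (F (-1ℤ ∷ α′) * e))) (insertAt-0ʷ r) (insertAt-0ʷ r) ⟨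
  c * d * (a′ * (b′ * e))
    ≡⟨ cong (λ z → c * d * (a′ * (b′ * z))) (∏-map (λ w → F (insertAt w (Fin.suc r) 0ℤ)) (0ℤ ∷_) (units n)) ⟨
  c * d * ∏ (λ w → F (insertAt w (Fin.suc r) 0ℤ)) (units (suc n)) ∎
  where
  open ≡-Reasoning
  a = F (1ℤ ∷ 0ʷ)
  b = F (-1ℤ ∷ 0ʷ)
  a′ = F (1ℤ ∷ insertAt 0ʷ r 0ℤ)
  b′ = F (-1ℤ ∷ insertAt 0ʷ r 0ℤ)
  c = F (0ℤ ∷ insertAt 0ʷ r 1ℤ)
  d = F (0ℤ ∷ insertAt 0ʷ r -1ℤ)
  e = ∏ (λ w → F (0ℤ ∷ insertAt w r 0ℤ)) (units n)
  swap : ∀ a b c d e → a * (b * (c * d * e)) ≡ c * d * (a * (b * e))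
  swap = solve-∀

insertAt-unit : ∀ {n} (r : Fin (suc n)) → IsUnit (insertAt 0ʷ r 1ℤ)
insertAt-unit         Fin.zero    = here +1 refl
insertAt-unit {suc n} (Fin.suc r) = there (insertAt-unit r)

∏-roots-++ : ∀ {n} (F : Weight (suc n) → ℤ) →
  ∏ F (roots (suc n)) ≡ ∏ (λ w → F (1ℤ ∷ w)) (units n) * ∏ (λ α → F (0ℤ ∷ α)) (roots n)
∏-roots-++ {n} F = trans (∏-++ F (List.map (1ℤ ∷_) (units n)) _)
  (cong₂ _*_ (∏-map F (1ℤ ∷_) (units n)) (∏-map F (0ℤ ∷_) (roots n)))

-- The roots ε_r ± ε_j with j before r are, up to sign, the remaining ones: each
-- position j < r contributes exactly one negative root ε_r - ε_j.
∏-roots-split : ∀ {n} (F : Weight (suc n) → ℤ) → (∀ {α} → IsRoot α → F (neg α) ≡ - F α) →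
  (r : Fin (suc n)) →
  ∏ F (roots (suc n)) ≡
  (-1ℤ ℤ.^ toℕ r) * (∏ (λ α → F (insertAt α r 0ℤ)) (roots n) * ∏ (λ w → F (insertAt w r 1ℤ)) (units n))
∏-roots-split {n} F odd Fin.zero = trans (∏-roots-++ F) (comm (∏ (λ w → F (1ℤ ∷ w)) (units n)) _)
  where
  comm : ∀ a b → a * b ≡ 1ℤ * (b * a)
  comm = solve-∀
∏-roots-split {suc n} F odd (Fin.suc r) = begin
  ∏ F (roots (suc (suc n)))
    ≡⟨ ∏-roots-++ F ⟩
  ∏ (λ w → F (1ℤ ∷ w)) (units (suc n)) * ∏ (λ α → F (0ℤ ∷ α)) (roots (suc n))
    ≡⟨ cong₂ _*_ (∏-units-split (F ∘ (1ℤ ∷_)) r) (∏-roots-split (F ∘ (0ℤ ∷_)) (odd ∘ there) r) ⟩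
  a * b * c * (m * (d * e))
    ≡⟨ cong (λ z → a * z * c * (m * (d * e))) b-odd ⟩
  a * (- b′) * c * (m * (d * e))
    ≡⟨ rearrange a b′ c d e m ⟩
  -1ℤ * m * (c * d * (a * (b′ * e)))
    ≡⟨ cong₂ (λ y z → -1ℤ * m * (y * z)) (∏-roots-++ (λ α → F (insertAt α (Fin.suc r) 0ℤ)))
        (cong (λ z → a * (b′ * z)) (∏-map (λ w → F (insertAt w (Fin.suc r) 1ℤ)) (0ℤ ∷_) (units n))) ⟨
  -1ℤ * m * (∏ (λ α → F (insertAt α (Fin.suc r) 0ℤ)) (roots (suc n)) *
    ∏ (λ w → F (insertAt w (Fin.suc r) 1ℤ)) (units (suc n))) ∎
  where
  open ≡-Reasoning
  m = -1ℤ ℤ.^ toℕ r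
  a = F (1ℤ ∷ insertAt 0ʷ r 1ℤ)
  b = F (1ℤ ∷ insertAt 0ʷ r -1ℤ)
  b′ = F (-1ℤ ∷ insertAt 0ʷ r 1ℤ)
  c = ∏ (λ w → F (1ℤ ∷ insertAt w r 0ℤ)) (units n)
  d = ∏ (λ α → F (0ℤ ∷ insertAt α r 0ℤ)) (roots n)
  e = ∏ (λ w → F (0ℤ ∷ insertAt w r 1ℤ)) (units n)
  b-odd : b ≡ - b′
  b-odd = trans (cong (λ α → F (1ℤ ∷ α))
      (sym (trans (Vec.map-insertAt -_ 1ℤ 0ʷ r) (cong (λ β → insertAt β r -1ℤ) (neg-0ʷ n)))))
    (odd (here −1 (insertAt-unit r)))
  rearrange : ∀ a b c d e m → a * (- b) * c * (m * (d * e)) ≡ -1ℤ * m * (c * d * (a * (b * e)))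
  rearrange = solve-∀

neg-∙ : ∀ {n} (σ : SignedMap n) β → σ ∙ neg β ≡ neg (σ ∙ β)
neg-∙ σ β = trans (Vec.map-cong (λ (s , r) →
    trans (cong ((s ◃ 1) *_) (Vec.lookup-map r -_ β)) (sym (ℤ.neg-distribʳ-* (s ◃ 1) (lookup β r)))) σ)
  (Vec.map-∘ -_ _ σ)

∏-units-const : ∀ c n → c * c ≡ 1ℤ → ∏ (λ _ → c) (units n) ≡ 1ℤ
∏-units-const c zero    c² = refl
∏-units-const c (suc n) c² = trans (sym (ℤ.*-assoc c c _)) (cong₂ _*_ c²
  (trans (∏-map (λ _ → c) (0ℤ ∷_) (units n)) (∏-units-const c n c²)))

-- The sign `s` cancels: it is the leading sign of the images of all 2n roots with entry 1 at
-- position `r`, an even number. So `sgn` sees only the underlying permutation, and the factor is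
-- the one of a Laplace expansion.
sgn-prepend : ∀ {n} s r {σ : SignedMap n} → IsSignedPermutation σ →
  sgn (prepend s r σ) ≡ (-1ℤ ℤ.^ toℕ r) * sgn σ
sgn-prepend {n} s r {σ} p = begin
  ∏ F (roots (suc n))
    ≡⟨ ∏-roots-split F (λ {α} q → trans (cong leading (neg-∙ (prepend s r σ) α)) (leading-neg (∙-root ((s , r) ∷ p) q))) r ⟩
  (-1ℤ ℤ.^ toℕ r) * (∏ (λ α → F (insertAt α r 0ℤ)) (roots n) * ∏ (λ w → F (insertAt w r 1ℤ)) (units n))
    ≡⟨ cong₂ (λ y z → (-1ℤ ℤ.^ toℕ r) * (y * z))
        (∏-cong (All.universal (λ α → trans (cong leading (insert-∙ α 0ℤ)) (cong (λ a → leading (a ∷ σ ∙ α)) (ℤ.*-zeroʳ (s ◃ 1)))) (roots n)))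
        (∏-cong (All.universal (λ w → trans (cong leading (insert-∙ w 1ℤ)) (leading-± s (σ ∙ w))) (units n))) ⟩
  (-1ℤ ℤ.^ toℕ r) * (sgn σ * ∏ (λ _ → s ◃ 1) (units n))
    ≡⟨ cong (λ z → (-1ℤ ℤ.^ toℕ r) * (sgn σ * z)) (∏-units-const (s ◃ 1) n (square s)) ⟩
  (-1ℤ ℤ.^ toℕ r) * (sgn σ * 1ℤ)
    ≡⟨ cong ((-1ℤ ℤ.^ toℕ r) *_) (ℤ.*-identityʳ (sgn σ)) ⟩
  (-1ℤ ℤ.^ toℕ r) * sgn σ ∎
  where
  open ≡-Reasoning
  F = λ α → leading (prepend s r σ ∙ α)
  insert-∙ : ∀ β a → prepend s r σ ∙ insertAt β r a ≡ (s ◃ 1) * a ∷ σ ∙ β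
  insert-∙ β a = trans (prepend-∙ s r σ (insertAt β r a))
    (cong₂ (λ b γ → (s ◃ 1) * b ∷ σ ∙ γ) (Vec.insertAt-lookup β r a) (Vec.removeAt-insertAt β r a))
  leading-± : ∀ s (β : Weight n) → leading ((s ◃ 1) * 1ℤ ∷ β) ≡ s ◃ 1
  leading-± Sign.+ β = refl
  leading-± Sign.- β = refl
  square : ∀ s → (s ◃ 1) * (s ◃ 1) ≡ 1ℤ
  square Sign.+ = refl
  square Sign.- = refl

-- Sums

∑ : ∀ {A : Set} → (A → ℤ) → List A → ℤ
∑ f xs = sumℤ (List.map f xs)

∑-cong : ∀ {A : Set} {f g : A → ℤ} → f ≗ g → ∀ xs → ∑ f xs ≡ ∑ g xs
∑-cong eq xs = cong sumℤ (List.map-cong eq xs)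

∑-cong-local : ∀ {A : Set} {f g : A → ℤ} {xs} → All (λ x → f x ≡ g x) xs → ∑ f xs ≡ ∑ g xs
∑-cong-local eqs = cong sumℤ (List.map-cong-local eqs)

∑-++ : ∀ {A : Set} (f : A → ℤ) xs ys → ∑ f (xs ++ ys) ≡ ∑ f xs + ∑ f ys
∑-++ f []       ys = sym (ℤ.+-identityˡ _)
∑-++ f (x ∷ xs) ys = trans (cong (λ z → f x + z) (∑-++ f xs ys)) (sym (ℤ.+-assoc (f x) _ _))

∑-map : ∀ {A B : Set} (f : B → ℤ) (g : A → B) xs → ∑ f (List.map g xs) ≡ ∑ (f ∘ g) xs
∑-map f g xs = cong sumℤ (sym (List.map-∘ xs))

∑-concatMap : ∀ {A B : Set} (f : B → ℤ) (g : A → List B) xs → ∑ f (concatMap g xs) ≡ ∑ (λ x → ∑ f (g x)) xs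
∑-concatMap f g []       = refl
∑-concatMap f g (x ∷ xs) = trans (∑-++ f (g x) _) (cong (λ z → ∑ f (g x) + z) (∑-concatMap f g xs))

∑-+ : ∀ {A : Set} (f g : A → ℤ) xs → ∑ (λ x → f x + g x) xs ≡ ∑ f xs + ∑ g xs
∑-+ f g []       = refl
∑-+ f g (x ∷ xs) = trans (cong (λ z → f x + g x + z) (∑-+ f g xs)) (interchange (f x) (g x) (∑ f xs) (∑ g xs))
  where
  interchange : ∀ a b c d → a + b + (c + d) ≡ a + c + (b + d)
  interchange = solve-∀

∑-*ˡ : ∀ {A : Set} c (f : A → ℤ) xs → ∑ (λ x → c * f x) xs ≡ c * ∑ f xs
∑-*ˡ c f []       = sym (ℤ.*-zeroʳ c)
∑-*ˡ c f (x ∷ xs) = trans (cong (λ z → c * f x + z) (∑-*ˡ c f xs)) (sym (ℤ.*-distribˡ-+ c (f x) _))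

∑-filter : ∀ {A : Set} {P : A → Set} (P? : Decidable P) (f : A → ℤ) xs →
  ∑ f (filter P? xs) ≡ ∑ (λ x → (if does (P? x) then 1ℤ else 0ℤ) * f x) xs
∑-filter P? f []       = refl
∑-filter P? f (x ∷ xs) with does (P? x)
... | true  = cong₂ _+_ (sym (ℤ.*-identityˡ (f x))) (∑-filter P? f xs)
... | false = trans (∑-filter P? f xs) (sym (ℤ.+-identityˡ _))

-- Laplace expansion

expand : ∀ {n} → (ℤ → Weight n → ℤ) → Weight (suc n) → ℤ
expand {zero}  g (a ∷ []) = g a []
expand {suc n} g (a ∷ x)  = g a x - expand (λ c v → g c (a ∷ v)) x

expand-cong : ∀ {n} {g h : ℤ → Weight n → ℤ} → (∀ c v → g c v ≡ h c v) → ∀ x → expand g x ≡ expand h x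
expand-cong {zero}  eq (a ∷ []) = eq a []
expand-cong {suc n} eq (a ∷ x)  = cong₂ _-_ (eq a x) (expand-cong (λ c v → eq c (a ∷ v)) x)

expand-+ : ∀ {n} (g h : ℤ → Weight n → ℤ) x → expand (λ c v → g c v + h c v) x ≡ expand g x + expand h x
expand-+ {zero}  g h (a ∷ []) = refl
expand-+ {suc n} g h (a ∷ x)  =
  trans (cong (λ z → g a x + h a x - z) (expand-+ (λ c v → g c (a ∷ v)) (λ c v → h c (a ∷ v)) x))
    (lemma (g a x) (h a x) _ _)
  where
  lemma : ∀ a b c d → a + b - (c + d) ≡ a - c + (b - d)
  lemma = solve-∀

expand-neg : ∀ {n} (g : ℤ → Weight n → ℤ) x → expand (λ c v → - g c v) x ≡ - expand g x
expand-neg {zero}  g (a ∷ []) = refl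
expand-neg {suc n} g (a ∷ x)  =
  trans (cong (λ z → - g a x - z) (expand-neg (λ c v → g c (a ∷ v)) x)) (lemma (g a x) _)
  where
  lemma : ∀ a b → - a - (- b) ≡ - (a - b)
  lemma = solve-∀

-- `expand` encodes the signs by nested subtraction, so that later inductions follow the vector
-- without mentioning positions. This connects it with the sum over positions that the enumeration
-- of signed permutations yields.
expand-sum : ∀ {n} (g : ℤ → Weight n → ℤ) x →
  ∑ (λ r → (-1ℤ ℤ.^ toℕ r) * g (lookup x r) (removeAt x r)) (allFin (suc n)) ≡ expand g x
expand-sum {zero}  g (a ∷ [])    = trans (ℤ.+-identityʳ _) (ℤ.*-identityˡ _)
expand-sum {suc n} g (a ∷ b ∷ x) = begin
  ∑ term (allFin (suc (suc n)))
    ≡⟨ cong (∑ term) (allFin-suc (suc n)) ⟩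
  term Fin.zero + ∑ term (List.map Fin.suc (allFin (suc n)))
    ≡⟨ cong₂ _+_ (ℤ.*-identityˡ (g a (b ∷ x))) (trans (∑-map term Fin.suc (allFin (suc n)))
        (trans (∑-cong (λ r → ℤ.*-assoc -1ℤ (-1ℤ ℤ.^ toℕ r) (g′ (lookup (b ∷ x) r) (removeAt (b ∷ x) r))) (allFin (suc n)))
          (∑-*ˡ -1ℤ (λ r → (-1ℤ ℤ.^ toℕ r) * g′ (lookup (b ∷ x) r) (removeAt (b ∷ x) r)) (allFin (suc n))))) ⟩
  g a (b ∷ x) + -1ℤ * ∑ (λ r → (-1ℤ ℤ.^ toℕ r) * g′ (lookup (b ∷ x) r) (removeAt (b ∷ x) r)) (allFin (suc n))
    ≡⟨ cong (λ z → g a (b ∷ x) + z) (trans (ℤ.-1*i≡-i _) (cong -_ (expand-sum g′ (b ∷ x)))) ⟩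
  expand g (a ∷ b ∷ x) ∎
  where
  open ≡-Reasoning
  term = λ r → (-1ℤ ℤ.^ toℕ r) * g (lookup (a ∷ b ∷ x) r) (removeAt (a ∷ b ∷ x) r)
  g′   = λ c v → g c (a ∷ v)

-- Alt e f x is the sum of sgn σ · f (σ ∙ x) over the signed permutations σ whose
-- number of sign changes has parity e.
Alt : ∀ {n} → Sign → (Weight n → ℤ) → Weight n → ℤ
Alt {zero}  Sign.+ f [] = f []
Alt {zero}  Sign.- f [] = 0ℤ
Alt {suc n} e f x =
  expand (λ c v → Alt e (λ u → f (c ∷ u)) v + Alt (Sign.opposite e) (λ u → f (- c ∷ u)) v) x

Alt-cong : ∀ {n} e {f g : Weight n → ℤ} → f ≗ g → Alt e f ≗ Alt e g
Alt-cong {zero}  Sign.+ eq [] = eq []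
Alt-cong {zero}  Sign.- eq [] = refl
Alt-cong {suc n} e      eq x  = expand-cong (λ c v → cong₂ _+_
  (Alt-cong e (λ u → eq (c ∷ u)) v) (Alt-cong (Sign.opposite e) (λ u → eq (- c ∷ u)) v)) x

Alt-+ : ∀ {n} e (f g : Weight n → ℤ) x → Alt e (λ u → f u + g u) x ≡ Alt e f x + Alt e g x
Alt-+ {zero}  Sign.+ f g [] = refl
Alt-+ {zero}  Sign.- f g [] = refl
Alt-+ {suc n} e      f g x  = trans
  (expand-cong (λ c v → trans (cong₂ _+_ (Alt-+ e _ _ v) (Alt-+ (Sign.opposite e) _ _ v))
    (interchange (Alt e (λ u → f (c ∷ u)) v) (Alt e (λ u → g (c ∷ u)) v) _ _)) x)
  (expand-+ _ _ x)
  where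
  interchange : ∀ a b c d → a + b + (c + d) ≡ a + c + (b + d)
  interchange = solve-∀

-- From the sum over W to the recursive alternating sum

even? : ℕ → ℤ
even? m = if does (2 ℕ∣.∣? m) then 1ℤ else 0ℤ

even?-suc-suc : ∀ m → even? (suc (suc m)) ≡ even? m
even?-suc-suc m = cong (λ b → if b then 1ℤ else 0ℤ)
  (does-⇔ (mk⇔ (λ 2∣m → ℕ∣.∣m+n∣m⇒∣n 2∣m ℕ∣.∣-refl) (ℕ∣.∣m∣n⇒∣m+n ℕ∣.∣-refl)) (2 ℕ∣.∣? suc (suc m)) (2 ℕ∣.∣? m))

shiftBy : Sign → ℕ → ℕ
shiftBy Sign.+ m = m
shiftBy Sign.- m = suc m

-- Stated for vectors over an arbitrary index type, because the tail of a signed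
-- map is not a signed map of smaller rank.
parity : ∀ {A : Set} {k} → Sign → Vec (Sign × A) k → ℤ
parity e []            = even? (shiftBy e 0)
parity e ((s , _) ∷ σ) = parity (s Sign.* e) σ

parity-map : ∀ {A B : Set} {k} (f : A → B) e (σ : Vec (Sign × A) k) →
  parity e (Vec.map (map₂ f) σ) ≡ parity e σ
parity-map f e []            = refl
parity-map f e ((s , _) ∷ σ) = parity-map f (s Sign.* e) σ

parity-count : ∀ {A : Set} {k} e (σ : Vec (Sign × A) k) →
  parity e σ ≡ even? (shiftBy e (Vec.count (λ x → proj₁ x Sign.≟ Sign.-) σ))
parity-count e      []                 = refl
parity-count e      ((Sign.+ , _) ∷ σ) = parity-count e σ
parity-count Sign.+ ((Sign.- , _) ∷ σ) = parity-count Sign.- σ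
parity-count Sign.- ((Sign.- , _) ∷ σ) = trans (parity-count Sign.+ σ) (sym (even?-suc-suc (Vec.count _ σ)))

signedPermutations-correct : ∀ n → All IsSignedPermutation (signedPermutations n)
signedPermutations-correct zero    = [] ∷ []
signedPermutations-correct (suc n) = All.concat⁺ (All.map⁺ (All.universal
  (λ e → All.map⁺ (All.map (e ∷_) (signedPermutations-correct n)))
  (cartesianProduct (Sign.+ ∷ Sign.- ∷ []) (allFin (suc n)))))

altTerm : ∀ {n} → Sign → (Weight n → ℤ) → Weight n → SignedMap n → ℤ
altTerm e f x σ = parity e σ * sgn σ * f (σ ∙ x)

altTerm-prepend : ∀ {n} e (f : Weight (suc n) → ℤ) x s r {σ} → IsSignedPermutation σ →
  altTerm e f x (prepend s r σ) ≡
  (-1ℤ ℤ.^ toℕ r) * altTerm (s Sign.* e) (λ u → f ((s ◃ 1) * lookup x r ∷ u)) (removeAt x r) σ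
altTerm-prepend e f x s r {σ} p = begin
  parity (s Sign.* e) (Vec.map (map₂ (punchIn r)) σ) * sgn (prepend s r σ) * f (prepend s r σ ∙ x)
    ≡⟨ cong₂ _*_ (cong₂ _*_ (parity-map (punchIn r) (s Sign.* e) σ) (sgn-prepend s r p)) (cong f (prepend-∙ s r σ x)) ⟩
  parity (s Sign.* e) σ * (m * sgn σ) * f ((s ◃ 1) * lookup x r ∷ σ ∙ removeAt x r)
    ≡⟨ rearrange (parity (s Sign.* e) σ) m (sgn σ) _ ⟩
  m * altTerm (s Sign.* e) (λ u → f ((s ◃ 1) * lookup x r ∷ u)) (removeAt x r) σ ∎
  where
  open ≡-Reasoning
  m = -1ℤ ℤ.^ toℕ r
  rearrange : ∀ a b c d → a * (b * c) * d ≡ b * (a * c * d)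
  rearrange = solve-∀

-- The sum runs over all signed permutations, with `parity` selecting the coset. Both values of `e`
-- are needed in the induction, because a sign change at the first entry leaves a tail of the
-- opposite parity.
altSum : ∀ {n} e (f : Weight n → ℤ) x → ∑ (altTerm e f x) (signedPermutations n) ≡ Alt e f x
altSum {zero}  Sign.+ f [] = trans (ℤ.+-identityʳ _) (ℤ.*-identityˡ _)
altSum {zero}  Sign.- f [] = refl
altSum {suc n} e f x = begin
  ∑ (altTerm e f x) (signedPermutations (suc n))
    ≡⟨ ∑-concatMap (altTerm e f x) (λ (s , r) → List.map (prepend s r) (signedPermutations n)) (cartesianProduct (Sign.+ ∷ Sign.- ∷ []) (allFin (suc n))) ⟩
  ∑ row (List.map (Sign.+ ,_) (allFin (suc n)) ++ List.map (Sign.- ,_) (allFin (suc n)) ++ [])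
    ≡⟨ trans (∑-++ row (List.map (Sign.+ ,_) (allFin (suc n))) _)
        (cong₂ _+_ (∑-map row (Sign.+ ,_) (allFin (suc n)))
          (trans (∑-++ row (List.map (Sign.- ,_) (allFin (suc n))) [])
            (trans (ℤ.+-identityʳ _) (∑-map row (Sign.- ,_) (allFin (suc n)))))) ⟩
  ∑ (λ r → row (Sign.+ , r)) (allFin (suc n)) + ∑ (λ r → row (Sign.- , r)) (allFin (suc n))
    ≡⟨ cong₂ _+_ (row-sum Sign.+ (λ c → c) ℤ.*-identityˡ) (row-sum Sign.- -_ ℤ.-1*i≡-i) ⟩
  expand (λ c v → Alt e (λ u → f (c ∷ u)) v) x + expand (λ c v → Alt (Sign.opposite e) (λ u → f (- c ∷ u)) v) x
    ≡⟨ expand-+ (λ c v → Alt e (λ u → f (c ∷ u)) v) (λ c v → Alt (Sign.opposite e) (λ u → f (- c ∷ u)) v) x ⟨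
  Alt e f x ∎
  where
  open ≡-Reasoning
  row : Sign × Fin (suc n) → ℤ
  row (s , r) = ∑ (altTerm e f x) (List.map (prepend s r) (signedPermutations n))
  row-sum : ∀ s (h : ℤ → ℤ) → (∀ c → (s ◃ 1) * c ≡ h c) →
    ∑ (λ r → row (s , r)) (allFin (suc n)) ≡ expand (λ c v → Alt (s Sign.* e) (λ u → f (h c ∷ u)) v) x
  row-sum s h eq = trans (∑-cong (λ r → begin
    row (s , r)
      ≡⟨ ∑-map (altTerm e f x) (prepend s r) (signedPermutations n) ⟩
    ∑ (λ σ → altTerm e f x (prepend s r σ)) (signedPermutations n)
      ≡⟨ ∑-cong-local (All.map (altTerm-prepend e f x s r) (signedPermutations-correct n)) ⟩
    ∑ (λ σ → (-1ℤ ℤ.^ toℕ r) * altTerm (s Sign.* e) (λ u → f ((s ◃ 1) * lookup x r ∷ u)) (removeAt x r) σ) (signedPermutations n)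
      ≡⟨ ∑-*ˡ (-1ℤ ℤ.^ toℕ r) _ (signedPermutations n) ⟩
    (-1ℤ ℤ.^ toℕ r) * ∑ (altTerm (s Sign.* e) (λ u → f ((s ◃ 1) * lookup x r ∷ u)) (removeAt x r)) (signedPermutations n)
      ≡⟨ cong ((-1ℤ ℤ.^ toℕ r) *_) (trans (altSum (s Sign.* e) _ (removeAt x r))
          (cong (λ c → Alt (s Sign.* e) (λ u → f (c ∷ u)) (removeAt x r)) (eq (lookup x r)))) ⟩
    (-1ℤ ℤ.^ toℕ r) * Alt (s Sign.* e) (λ u → f (h (lookup x r) ∷ u)) (removeAt x r) ∎) (allFin (suc n)))
    (expand-sum (λ c v → Alt (s Sign.* e) (λ u → f (h c ∷ u)) v) x)

-- `K` as a function of λ + ρ and μ + ρ. Removing coordinates and translating lead to vectors that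
-- are not of the form dominant weight plus ρ, so arbitrary arguments are allowed.
D : ∀ {n} → Weight n → Weight n → Series
D x y k = Alt Sign.+ (λ v → 𝒫 (v ⊟ y) k) x

K≗D : ∀ {n} (lam mu : Weight n) → K lam mu ≗ D (lam ⊞ ρ n) (mu ⊞ ρ n)
K≗D {n} lam mu k = begin
  ∑ (λ σ → (-1ℤ ℤ.^ l σ) * f (σ ∙ x)) (W n)
    ≡⟨ ∑-filter (λ σ → 2 ℕ∣.∣? signChanges σ) _ (signedPermutations n) ⟩
  ∑ (λ σ → even? (signChanges σ) * ((-1ℤ ℤ.^ l σ) * f (σ ∙ x))) (signedPermutations n)
    ≡⟨ ∑-cong-local (All.map (λ {σ} p → trans
        (cong₂ (λ y z → y * (z * f (σ ∙ x))) (sym (parity-count Sign.+ σ)) (length-sgn p))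
        (sym (ℤ.*-assoc (parity Sign.+ σ) (sgn σ) (f (σ ∙ x))))) (signedPermutations-correct n)) ⟩
  ∑ (altTerm Sign.+ f x) (signedPermutations n)
    ≡⟨ altSum Sign.+ f x ⟩
  D x (mu ⊞ ρ n) k ∎
  where
  open ≡-Reasoning
  x = lam ⊞ ρ n
  f = λ v → 𝒫 (v ⊟ (mu ⊞ ρ n)) k

-- The q-partition function in terms of the first coordinate

divide : ∀ {n} → List (Weight n) → FormalSum n → FormalSum n
divide αs F = List.foldr (λ α G → G ÷⟨1-qx^ α ⟩) F αs

-- Multiplication by `q`.
shift : Series → Series
shift F zero    = 0ℤ
shift F (suc k) = F k

shift-cong : ∀ {F G} → F ≗ G → shift F ≗ shift G
shift-cong eq zero    = refl
shift-cong eq (suc k) = eq k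

-- The second complete symmetric function of `us`, acting by translations: one summand for every
-- multiset of two list entries.
pairSum : ∀ {n} → (Weight n → ℤ) → List (Weight n) → Weight n → ℤ
pairSum f []       β = 0ℤ
pairSum f (u ∷ us) β = pairSum f us β + ∑ (λ u′ → f (β ⊟ u ⊟ u′)) (u ∷ us)

divide-0∷ : ∀ {n} (αs : List (Weight n)) β k → divide (List.map (0ℤ ∷_) αs) one (0ℤ ∷ β) k ≡ divide αs one β k
divide-0∷ []       β k       = refl
divide-0∷ (α ∷ αs) β zero    = divide-0∷ αs β zero
divide-0∷ (α ∷ αs) β (suc k) = cong₂ _+_ (divide-0∷ αs β (suc k)) (divide-0∷ (α ∷ αs) (β ⊟ α) k)

divide-0∷-support : ∀ {n} (αs : List (Weight n)) {b} β k → b ≢ 0ℤ →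
  divide (List.map (0ℤ ∷_) αs) one (b ∷ β) k ≡ 0ℤ
divide-0∷-support {n} [] {b} β k b≢0
  rewrite dec-false ((b ∷ β) ≟ʷ 0ʷ) (b≢0 ∘ cong Vec.head) = refl
divide-0∷-support (α ∷ αs)     β zero    b≢0 = divide-0∷-support αs β zero b≢0
divide-0∷-support (α ∷ αs) {b} β (suc k) b≢0 = cong₂ _+_ (divide-0∷-support αs β (suc k) b≢0)
  (divide-0∷-support (α ∷ αs) (β ⊟ α) k (b≢0 ∘ trans (sym (ℤ.+-identityʳ b))))

module _ {n} (F : FormalSum (suc n)) (support : ∀ {b} β k → b ≢ 0ℤ → F (b ∷ β) k ≡ 0ℤ) where

  divide-1∷-neg : ∀ us m β k → divide (List.map (1ℤ ∷_) us) F (-[1+ m ] ∷ β) k ≡ 0ℤ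
  divide-1∷-neg []       m β k       = support β k λ ()
  divide-1∷-neg (u ∷ us) m β zero    = divide-1∷-neg us m β zero
  divide-1∷-neg (u ∷ us) m β (suc k) =
    -- `-[1+ m ] - 1ℤ` reduces to `-[1+ suc (m ℕ.+ 0) ]`.
    cong₂ _+_ (divide-1∷-neg us m β (suc k)) (divide-1∷-neg (u ∷ us) (suc (m ℕ.+ 0)) (β ⊟ u) k)

  divide-1∷-0 : ∀ us β k → divide (List.map (1ℤ ∷_) us) F (+ 0 ∷ β) k ≡ F (+ 0 ∷ β) k
  divide-1∷-0 []       β k       = refl
  divide-1∷-0 (u ∷ us) β zero    = divide-1∷-0 us β zero
  divide-1∷-0 (u ∷ us) β (suc k) = trans
    (cong₂ _+_ (divide-1∷-0 us β (suc k)) (divide-1∷-neg (u ∷ us) 0 (β ⊟ u) k)) (ℤ.+-identityʳ _)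

  divide-1∷-1 : ∀ us β k → divide (List.map (1ℤ ∷_) us) F (+ 1 ∷ β) k ≡
    shift (λ k → ∑ (λ u → F (+ 0 ∷ β ⊟ u) k) us) k
  divide-1∷-1 []       β zero    = support β zero λ ()
  divide-1∷-1 []       β (suc k) = support β (suc k) λ ()
  divide-1∷-1 (u ∷ us) β zero    = divide-1∷-1 us β zero
  divide-1∷-1 (u ∷ us) β (suc k) = trans
    (cong₂ _+_ (divide-1∷-1 us β (suc k)) (divide-1∷-0 (u ∷ us) (β ⊟ u) k)) (ℤ.+-comm _ (F (+ 0 ∷ β ⊟ u) k))

  shift-+ : ∀ (G H : Series) k → shift G k + shift H k ≡ shift (λ k → G k + H k) k
  shift-+ G H zero    = refl
  shift-+ G H (suc k) = refl

  -- Deciding whether the root with tail `u` is used reproduces the recursion of `pairSum`; the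
  -- inner sum there includes `u` because a root may be used twice.
  divide-1∷-2 : ∀ us β k → divide (List.map (1ℤ ∷_) us) F (+ 2 ∷ β) k ≡
    shift (shift (λ k → pairSum (λ γ → F (+ 0 ∷ γ) k) us β)) k
  divide-1∷-2 []       β zero          = support β zero λ ()
  divide-1∷-2 []       β (suc zero)    = support β 1 λ ()
  divide-1∷-2 []       β (suc (suc k)) = support β (suc (suc k)) λ ()
  divide-1∷-2 (u ∷ us) β zero          = divide-1∷-2 us β zero
  divide-1∷-2 (u ∷ us) β (suc k)       = trans
    (cong₂ _+_ (divide-1∷-2 us β (suc k)) (divide-1∷-1 (u ∷ us) (β ⊟ u) k))
    (shift-+ (λ k → pairSum (λ γ → F (+ 0 ∷ γ) k) us β) _ k)

private
  F₀ : ∀ n → FormalSum (suc n)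
  F₀ n = divide (List.map (0ℤ ∷_) (roots n)) one

  F₀-support : ∀ n {b} β k → b ≢ 0ℤ → F₀ n (b ∷ β) k ≡ 0ℤ
  F₀-support n = divide-0∷-support (roots n)

  𝒫-roots : ∀ {n} (β : Weight n) k → 𝒫 β k ≡ divide (roots n) one β k
  𝒫-roots {n} β k = cong (λ αs → divide αs one β k) (positiveRoots≡roots n)

  𝒫-split : ∀ {n} (β : Weight (suc n)) k → 𝒫 β k ≡ divide (List.map (1ℤ ∷_) (units n)) (F₀ n) β k
  𝒫-split {n} β k = trans (𝒫-roots β k)
    (cong (λ G → G β k) (List.foldr-++ (λ α G → G ÷⟨1-qx^ α ⟩) one (List.map (1ℤ ∷_) (units n)) _))

  F₀-0∷ : ∀ n β k → F₀ n (+ 0 ∷ β) k ≡ 𝒫 β k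
  F₀-0∷ n β k = trans (divide-0∷ (roots n) β k) (sym (𝒫-roots β k))

pairSum-cong : ∀ {n} {f g : Weight n → ℤ} → f ≗ g → ∀ us β → pairSum f us β ≡ pairSum g us β
pairSum-cong eq []       β = refl
pairSum-cong eq (u ∷ us) β = cong₂ _+_ (pairSum-cong eq us β) (∑-cong (λ u′ → eq (β ⊟ u ⊟ u′)) (u ∷ us))

𝒫-neg : ∀ {n b} → b ℤ.< 0ℤ → ∀ (β : Weight n) k → 𝒫 (b ∷ β) k ≡ 0ℤ
𝒫-neg {n} (ℤ.-<+ {m}) β k = trans (𝒫-split (-[1+ m ] ∷ β) k) (divide-1∷-neg (F₀ n) (F₀-support n) (units n) m β k)

𝒫-0 : ∀ {n} (β : Weight n) k → 𝒫 (+ 0 ∷ β) k ≡ 𝒫 β k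
𝒫-0 {n} β k = trans (𝒫-split (+ 0 ∷ β) k)
  (trans (divide-1∷-0 (F₀ n) (F₀-support n) (units n) β k) (F₀-0∷ n β k))

𝒫-1 : ∀ {n} (β : Weight n) k → 𝒫 (+ 1 ∷ β) k ≡ shift (λ k → ∑ (λ u → 𝒫 (β ⊟ u) k) (units n)) k
𝒫-1 {n} β k = trans (𝒫-split (+ 1 ∷ β) k) (trans (divide-1∷-1 (F₀ n) (F₀-support n) (units n) β k)
  (shift-cong (λ k → ∑-cong (λ u → F₀-0∷ n (β ⊟ u) k) (units n)) k))

𝒫-2 : ∀ {n} (β : Weight n) k → 𝒫 (+ 2 ∷ β) k ≡ shift (shift (λ k → pairSum (λ γ → 𝒫 γ k) (units n) β)) k
𝒫-2 {n} β k = trans (𝒫-split (+ 2 ∷ β) k) (trans (divide-1∷-2 (F₀ n) (F₀-support n) (units n) β k)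
  (shift-cong (shift-cong (λ k → pairSum-cong (λ γ → F₀-0∷ n γ k) (units n) β)) k))

⊟-swap : ∀ {n} (β γ δ : Weight n) → β ⊟ γ ⊟ δ ≡ β ⊟ δ ⊟ γ
⊟-swap []      []      []      = refl
⊟-swap (b ∷ β) (c ∷ γ) (d ∷ δ) = cong₂ _∷_ (lemma b c d) (⊟-swap β γ δ)
  where
  lemma : ∀ b c d → b - c - d ≡ b - d - c
  lemma = solve-∀

-- Newton's identity 2h₂ = p₁² + p₂. It replaces multisets by single translations, which commute
-- with alternating sums; doubling keeps it integral.
double-pairSum : ∀ {n} (f : Weight n → ℤ) us β →
  pairSum f us β + pairSum f us β ≡
  ∑ (λ u → ∑ (λ u′ → f (β ⊟ u ⊟ u′)) us) us + ∑ (λ u → f (β ⊟ u ⊟ u)) us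
double-pairSum f []       β = refl
double-pairSum f (u ∷ us) β = begin
  (h + (d + r)) + (h + (d + r))
    ≡⟨ lemma₁ h d r ⟩
  (h + h) + (d + r + (r + d))
    ≡⟨ cong (λ z → z + (d + r + (r + d))) (double-pairSum f us β) ⟩
  (s + t) + (d + r + (r + d))
    ≡⟨ lemma₂ s t d r ⟩
  d + r + (r + s) + (d + t)
    -- The mixed pairs occur in p₁² in both orders; one of the two copies of `r` is rewritten with
    -- the order exchanged and becomes a column of the square.
    ≡⟨ cong (λ z → d + r + z + (d + t)) (trans
        (cong (λ z → z + s) (∑-cong (λ u′ → cong f (⊟-swap β u u′)) us)) (sym (∑-+ (λ u′ → f (β ⊟ u′ ⊟ u)) _ us))) ⟩
  d + r + ∑ (λ u′ → f (β ⊟ u′ ⊟ u) + ∑ (λ u″ → f (β ⊟ u′ ⊟ u″)) us) us + (d + t) ∎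
  where
  open ≡-Reasoning
  h = pairSum f us β
  d = f (β ⊟ u ⊟ u)
  r = ∑ (λ u′ → f (β ⊟ u ⊟ u′)) us
  s = ∑ (λ u → ∑ (λ u′ → f (β ⊟ u ⊟ u′)) us) us
  t = ∑ (λ u → f (β ⊟ u ⊟ u)) us
  lemma₁ : ∀ h d r → (h + (d + r)) + (h + (d + r)) ≡ (h + h) + (d + r + (r + d))
  lemma₁ = solve-∀
  lemma₂ : ∀ s t d r → (s + t) + (d + r + (r + d)) ≡ d + r + (r + s) + (d + t)
  lemma₂ = solve-∀

-- Translation operators

T : ∀ {n} → ℤ → (Weight n → ℤ) → Weight n → ℤ
T d f []      = 0ℤ
T d f (a ∷ x) = f (a + d ∷ x) + f (a - d ∷ x) + T d (λ v → f (a ∷ v)) x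

T-cong : ∀ {n} d {f g : Weight n → ℤ} → f ≗ g → T d f ≗ T d g
T-cong d eq []      = refl
T-cong d eq (a ∷ x) =
  cong₂ _+_ (cong₂ _+_ (eq (a + d ∷ x)) (eq (a - d ∷ x))) (T-cong d (λ v → eq (a ∷ v)) x)

T-+ : ∀ {n} d (f g : Weight n → ℤ) x → T d (λ v → f v + g v) x ≡ T d f x + T d g x
T-+ d f g []      = refl
T-+ d f g (a ∷ x) = trans
  (cong (λ z → f (a + d ∷ x) + g (a + d ∷ x) + (f (a - d ∷ x) + g (a - d ∷ x)) + z) (T-+ d _ _ x))
  (lemma (f (a + d ∷ x)) (g (a + d ∷ x)) (f (a - d ∷ x)) (g (a - d ∷ x)) _ _)
  where
  lemma : ∀ a b c d e f → a + b + (c + d) + (e + f) ≡ a + c + e + (b + d + f)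
  lemma = solve-∀

T-neg : ∀ {n} d (f : Weight n → ℤ) x → T d (λ v → - f v) x ≡ - T d f x
T-neg d f []      = refl
T-neg d f (a ∷ x) = trans
  (cong (λ z → - f (a + d ∷ x) + (- f (a - d ∷ x)) + z) (T-neg d _ x))
  (lemma (f (a + d ∷ x)) (f (a - d ∷ x)) _)
  where
  lemma : ∀ a b c → - a + (- b) + (- c) ≡ - (a + b + c)
  lemma = solve-∀

∑-units-T : ∀ {n} (f : Weight n → ℤ) v → ∑ (λ u → f (v ⊟ u)) (units n) ≡ T 1ℤ f v
∑-units-T f []      = refl
∑-units-T {suc n} f (a ∷ v) = begin
  f (a - 1ℤ ∷ v ⊟ 0ʷ) + (f (a + 1ℤ ∷ v ⊟ 0ʷ) + ∑ (λ u → f ((a ∷ v) ⊟ u)) (List.map (0ℤ ∷_) (units n)))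
    ≡⟨ cong₂ (λ z s → f (a - 1ℤ ∷ z) + (f (a + 1ℤ ∷ z) + s)) (⊟-identityʳ v)
        (trans (∑-map (λ u → f ((a ∷ v) ⊟ u)) (0ℤ ∷_) (units n))
          (trans (cong (λ b → ∑ (λ u → f (b ∷ v ⊟ u)) (units n)) (ℤ.+-identityʳ a)) (∑-units-T (λ v → f (a ∷ v)) v))) ⟩
  f (a - 1ℤ ∷ v) + (f (a + 1ℤ ∷ v) + T 1ℤ (λ v → f (a ∷ v)) v)
    ≡⟨ lemma (f (a - 1ℤ ∷ v)) (f (a + 1ℤ ∷ v)) _ ⟩
  T 1ℤ f (a ∷ v) ∎
  where
  open ≡-Reasoning
  lemma : ∀ a b c → a + (b + c) ≡ b + a + c
  lemma = solve-∀

∑-units-T₂ : ∀ {n} (f : Weight n → ℤ) v → ∑ (λ u → f (v ⊟ u ⊟ u)) (units n) ≡ T (+ 2) f v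
∑-units-T₂ f []      = refl
∑-units-T₂ {suc n} f (a ∷ v) = begin
  f (a - 1ℤ - 1ℤ ∷ v ⊟ 0ʷ ⊟ 0ʷ) + (f (a + 1ℤ + 1ℤ ∷ v ⊟ 0ʷ ⊟ 0ʷ) + ∑ (λ u → f ((a ∷ v) ⊟ u ⊟ u)) (List.map (0ℤ ∷_) (units n)))
    ≡⟨ cong₂ (λ z s → f (a - 1ℤ - 1ℤ ∷ z) + (f (a + 1ℤ + 1ℤ ∷ z) + s)) (trans (⊟-identityʳ (v ⊟ 0ʷ)) (⊟-identityʳ v))
        (trans (∑-map (λ u → f ((a ∷ v) ⊟ u ⊟ u)) (0ℤ ∷_) (units n))
          (trans (cong (λ b → ∑ (λ u → f (b ∷ v ⊟ u ⊟ u)) (units n)) (trans (ℤ.+-identityʳ (a - 0ℤ)) (ℤ.+-identityʳ a)))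
            (∑-units-T₂ (λ v → f (a ∷ v)) v))) ⟩
  f (a - 1ℤ - 1ℤ ∷ v) + (f (a + 1ℤ + 1ℤ ∷ v) + T (+ 2) (λ v → f (a ∷ v)) v)
    ≡⟨ cong₂ (λ b c → f (b ∷ v) + (f (c ∷ v) + T (+ 2) (λ v → f (a ∷ v)) v)) (ℤ.+-assoc a -1ℤ -1ℤ) (ℤ.+-assoc a 1ℤ 1ℤ) ⟩
  f (a - + 2 ∷ v) + (f (a + + 2 ∷ v) + T (+ 2) (λ v → f (a ∷ v)) v)
    ≡⟨ lemma (f (a - + 2 ∷ v)) (f (a + + 2 ∷ v)) _ ⟩
  T (+ 2) f (a ∷ v) ∎
  where
  open ≡-Reasoning
  lemma : ∀ a b c → a + (b + c) ≡ b + a + c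
  lemma = solve-∀

-- A Leibniz rule: a translation moves either the entry that is expanded or one of those left
-- behind.
expand-T : ∀ {n} d (g : ℤ → Weight n → ℤ) x →
  expand (λ c v → g (c + d) v + g (c - d) v + T d (g c) v) x ≡ T d (expand g) x
expand-T {zero}  d g (a ∷ []) = refl
expand-T {suc n} d g (a ∷ x)  = begin
  p + q + t - expand (λ c v → g (c + d) (a ∷ v) + g (c - d) (a ∷ v) + T d (g c) (a ∷ v)) x
    ≡⟨ cong (λ z → p + q + t - z) (trans (expand-cong (λ c v → regroup (g (c + d) (a ∷ v)) (g (c - d) (a ∷ v)) (g c (a + d ∷ v)) (g c (a - d ∷ v)) _) x)
        (trans (expand-+ (λ c v → g′ (c + d) v + g′ (c - d) v + T d (g′ c) v) (λ c v → g c (a + d ∷ v) + g c (a - d ∷ v)) x)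
          (cong₂ _+_ (expand-T d g′ x) (expand-+ (λ c v → g c (a + d ∷ v)) (λ c v → g c (a - d ∷ v)) x)))) ⟩
  p + q + t - (T d (expand g′) x + (e + e′))
    ≡⟨ regroup′ p q t (T d (expand g′) x) e e′ ⟩
  p - e + (q - e′) + (t + (- T d (expand g′) x))
    ≡⟨ cong (λ z → p - e + (q - e′) + z) (trans (cong (λ z → t + z) (sym (T-neg d (expand g′) x))) (sym (T-+ d (g a) _ x))) ⟩
  T d (expand g) (a ∷ x) ∎
  where
  open ≡-Reasoning
  g′ = λ c v → g c (a ∷ v)
  p  = g (a + d) x
  q  = g (a - d) x
  t  = T d (g a) x
  e  = expand (λ c v → g c (a + d ∷ v)) x
  e′ = expand (λ c v → g c (a - d ∷ v)) x
  regroup : ∀ a b c d e → a + b + (c + d + e) ≡ a + b + e + (c + d)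
  regroup = solve-∀
  regroup′ : ∀ p q t s e f → p + q + t - (s + (e + f)) ≡ p - e + (q - f) + (t + (- s))
  regroup′ = solve-∀

-- Every signed permutation permutes the vectors ±d ε_j. Thus the sum over roots through the first
-- coordinate moves from the argument of `𝒫` to λ + ρ, where alternation kills most terms.
Alt-T : ∀ {n} e d (f : Weight n → ℤ) x → Alt e (T d f) x ≡ T d (Alt e f) x
Alt-T {zero}  Sign.+ d f [] = refl
Alt-T {zero}  Sign.- d f [] = refl
Alt-T {suc n} e      d f x  = trans (expand-cong step x) (expand-T d g x)
  where
  open ≡-Reasoning
  ē = Sign.opposite e
  A B : ℤ → Weight n → ℤ
  A c = Alt e (λ u → f (c ∷ u))
  B c = Alt ē (λ u → f (- c ∷ u))
  g = λ c v → A c v + B c v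
  slice : ∀ e c v → Alt e (λ u → T d f (c ∷ u)) v ≡
    Alt e (λ u → f (c + d ∷ u)) v + Alt e (λ u → f (c - d ∷ u)) v + T d (Alt e (λ u → f (c ∷ u))) v
  slice e c v = trans (Alt-+ e (λ u → f (c + d ∷ u) + f (c - d ∷ u)) _ v)
    (cong₂ _+_ (Alt-+ e (λ u → f (c + d ∷ u)) _ v) (Alt-T e d (λ u → f (c ∷ u)) v))
  neg₁ : ∀ c d → - c + d ≡ - (c - d)
  neg₁ = solve-∀
  neg₂ : ∀ c d → - c - d ≡ - (c + d)
  neg₂ = solve-∀
  regroup : ∀ a b c d e f → a + b + c + (d + e + f) ≡ a + e + (b + d) + (c + f)
  regroup = solve-∀
  step : ∀ c v → Alt e (λ u → T d f (c ∷ u)) v + Alt ē (λ u → T d f (- c ∷ u)) v ≡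
    g (c + d) v + g (c - d) v + T d (g c) v
  step c v = begin
    Alt e (λ u → T d f (c ∷ u)) v + Alt ē (λ u → T d f (- c ∷ u)) v
      -- Adding `d` to `- c` subtracts it from `c`, so the two translates of `B` appear in the
      -- opposite order.
      ≡⟨ cong₂ _+_ (slice e c v) (trans (slice ē (- c) v) (cong₂ (λ y z →
          Alt ē (λ u → f (y ∷ u)) v + Alt ē (λ u → f (z ∷ u)) v + T d (B c) v) (neg₁ c d) (neg₂ c d))) ⟩
    A (c + d) v + A (c - d) v + T d (A c) v + (B (c - d) v + B (c + d) v + T d (B c) v)
      ≡⟨ regroup (A (c + d) v) (A (c - d) v) (T d (A c) v) (B (c - d) v) (B (c + d) v) (T d (B c) v) ⟩
    g (c + d) v + g (c - d) v + (T d (A c) v + T d (B c) v)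
      ≡⟨ cong (λ z → g (c + d) v + g (c - d) v + z) (T-+ d (A c) (B c) v) ⟨
    g (c + d) v + g (c - d) v + T d (g c) v ∎

-- Alternating families

data Swap : ∀ {n} → Weight n → Weight n → Set where
  here  : ∀ {n a b} {x : Weight n} → Swap (a ∷ b ∷ x) (b ∷ a ∷ x)
  there : ∀ {n a} {x y : Weight n} → Swap x y → Swap (a ∷ x) (a ∷ y)

data Flip : ∀ {n} → Weight n → Weight n → Set where
  here  : ∀ {n a} {x : Weight n} → Flip (a ∷ x) (- a ∷ x)
  there : ∀ {n a} {x y : Weight n} → Flip x y → Flip (a ∷ x) (a ∷ y)

-- A single sign change is not in W; it exchanges the two members of the family.
record Alternating {n} (F : Sign → Weight n → ℤ) : Set where
  field
    swap : ∀ e {x y} → Swap x y → F e x ≡ - F e y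
    flip : ∀ e {x y} → Flip x y → F e x ≡ F (Sign.opposite e) y

expand-swap : ∀ {n} (g : ℤ → Weight n → ℤ) → (∀ c {v w} → Swap v w → g c v ≡ - g c w) →
  ∀ {x y} → Swap x y → expand g x ≡ - expand g y
expand-swap {suc zero} g alt (here {a = a} {b} {[]}) = lemma (g a (b ∷ [])) (g b (a ∷ []))
  where
  lemma : ∀ a b → a - b ≡ - (b - a)
  lemma = solve-∀
-- The first two terms trade places; all later terms keep the swapped pair in the remaining vector,
-- so `alt` applies to them.
expand-swap {suc (suc n)} g alt (here {a = a} {b} {x}) = begin
  g a (b ∷ x) - (g b (a ∷ x) - expand (λ c v → g c (a ∷ b ∷ v)) x)
    ≡⟨ cong (λ z → g a (b ∷ x) - (g b (a ∷ x) - z)) (trans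
        (expand-cong (λ c v → alt c (here {a = a} {b} {v})) x) (expand-neg (λ c v → g c (b ∷ a ∷ v)) x)) ⟩
  g a (b ∷ x) - (g b (a ∷ x) - (- expand (λ c v → g c (b ∷ a ∷ v)) x))
    ≡⟨ lemma (g a (b ∷ x)) (g b (a ∷ x)) _ ⟩
  - (g b (a ∷ x) - (g a (b ∷ x) - expand (λ c v → g c (b ∷ a ∷ v)) x)) ∎
  where
  open ≡-Reasoning
  lemma : ∀ a b c → a - (b - (- c)) ≡ - (b - (a - c))
  lemma = solve-∀
expand-swap {suc n} g alt (there {a = a} {x} {y} s) = trans
  (cong₂ _-_ (alt a s) (expand-swap (λ c v → g c (a ∷ v)) (λ c t → alt c (there t)) s))
  (lemma (g a y) _)
  where
  lemma : ∀ a b → - a - (- b) ≡ - (a - b)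
  lemma = solve-∀

expand-flip : ∀ {n} (g h : ℤ → Weight n → ℤ) → (∀ c v → g c v ≡ h (- c) v) →
  (∀ c {v w} → Flip v w → g c v ≡ h c w) → ∀ {x y} → Flip x y → expand g x ≡ expand h y
expand-flip {zero}  g h neg alt (here {a = a} {[]}) = neg a []
expand-flip {suc n} g h neg alt (here {a = a} {x}) =
  cong₂ _-_ (neg a x) (expand-cong (λ c v → alt c (here {a = a} {v})) x)
expand-flip {suc n} g h neg alt (there {a = a} f) =
  cong₂ _-_ (alt a f) (expand-flip _ _ (λ c v → neg c (a ∷ v)) (λ c t → alt c (there t)) f)

opposite-involutive : ∀ e → Sign.opposite (Sign.opposite e) ≡ e
opposite-involutive Sign.+ = refl
opposite-involutive Sign.- = refl

open Alternating

Alt-alternating : ∀ {n} (f : Weight n → ℤ) → Alternating (λ e → Alt e f)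
Alt-alternating {zero}  f = record { swap = λ _ () ; flip = λ _ () }
Alt-alternating {suc n} f = record
  { swap = λ e → expand-swap _ (λ c {v} {w} s → trans
      (cong₂ _+_ (swap (Alt-alternating _) e s) (swap (Alt-alternating _) (Sign.opposite e) s))
      (sym (ℤ.neg-distrib-+ (Alt e (λ u → f (c ∷ u)) w) _)))
  ; flip = λ e → expand-flip _ _ (negate e) (λ c s →
      cong₂ _+_ (flip (Alt-alternating _) e s) (flip (Alt-alternating _) (Sign.opposite e) s))
  }
  where
  -- Negating the entry exchanges the two summands of `Alt` and opposes the parity.
  negate : ∀ e c v →
    Alt e (λ u → f (c ∷ u)) v + Alt (Sign.opposite e) (λ u → f (- c ∷ u)) v ≡
    Alt (Sign.opposite e) (λ u → f (- c ∷ u)) v + Alt (Sign.opposite (Sign.opposite e)) (λ u → f (- - c ∷ u)) v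
  negate e c v = trans (ℤ.+-comm (Alt e (λ u → f (c ∷ u)) v) _)
    (cong (λ z → Alt (Sign.opposite e) (λ u → f (- c ∷ u)) v + z)
      (sym (cong₂ (λ e a → Alt e (λ u → f (a ∷ u)) v) (opposite-involutive e) (ℤ.neg-involutive c))))

Alternating-resp : ∀ {n} {F G : Sign → Weight n → ℤ} → (∀ e → F e ≗ G e) → Alternating F → Alternating G
Alternating-resp eq A = record
  { swap = λ e {x} {y} s → trans (sym (eq e x)) (trans (swap A e s) (cong -_ (eq e y)))
  ; flip = λ e {x} {y} s → trans (sym (eq e x)) (trans (flip A e s) (eq _ y))
  }

-- Needed for the outer of the two translations in p₁².
T-alternating : ∀ {n} d (f : Weight n → ℤ) → Alternating (λ e → T d (Alt e f))
T-alternating d f = Alternating-resp (λ e → Alt-T e d f) (Alt-alternating (T d f))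

i≡-i⇒i≡0 : ∀ {i} → i ≡ - i → i ≡ 0ℤ
i≡-i⇒i≡0 {+ zero}   _ = refl

tail : ∀ {n F a} → Alternating {suc n} F → Alternating (λ e v → F e (a ∷ v))
tail A = record { swap = λ e s → swap A e (there s) ; flip = λ e s → flip A e (there s) }

module _ {n} {F : Sign → Weight (suc (suc n)) → ℤ} (A : Alternating F) where

  equal : ∀ e a x → F e (a ∷ a ∷ x) ≡ 0ℤ
  equal e a x = i≡-i⇒i≡0 (swap A e here)

  -- One sign change makes the entries equal and passes to the other parity, whose values at equal
  -- entries vanish as well.
  antipodal : ∀ e a x → F e (a ∷ - a ∷ x) ≡ 0ℤ
  antipodal e a x = trans (flip A e (there here))
    (trans (cong (λ z → F _ (a ∷ z ∷ x)) (ℤ.neg-involutive a)) (i≡-i⇒i≡0 (swap A (Sign.opposite e) here)))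

  flip₂ : ∀ e a b x → F e (- a ∷ - b ∷ x) ≡ F e (a ∷ b ∷ x)
  flip₂ e a b x = trans (flip A e here) (trans (flip A _ (there here))
    (cong₂ (λ e z → F e z) (opposite-involutive e)
      (cong₂ (λ a b → a ∷ b ∷ x) (ℤ.neg-involutive a) (ℤ.neg-involutive b))))

module _ {n} {F : Sign → Weight (suc (suc (suc n))) → ℤ} (A : Alternating F) where

  equal₂ : ∀ e a b x → F e (a ∷ b ∷ a ∷ x) ≡ 0ℤ
  equal₂ e a b x = trans (swap A e (there here)) (cong -_ (equal A e a (b ∷ x)))

  antipodal₂ : ∀ e a b x → F e (a ∷ b ∷ - a ∷ x) ≡ 0ℤ
  antipodal₂ e a b x = trans (swap A e (there here)) (cong -_ (antipodal A e a (b ∷ x)))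

-- Translates of ρ that survive in an alternating family

staircase : ∀ n → Weight n
staircase zero    = []
staircase (suc n) = + n ∷ staircase n

private
  +1≡suc : ∀ m → + m + 1ℤ ≡ + suc m
  +1≡suc m = cong +_ (ℕ.+-comm m 1)

  +2≡suc² : ∀ m → + m + + 2 ≡ + suc (suc m)
  +2≡suc² m = cong +_ (ℕ.+-comm m 2)

-- A raised entry equals its predecessor and a lowered one its successor; the final 0 becomes 1 or
-- -1 and meets the 1 in front of it.
T₁-tail : ∀ n {F} → Alternating F → ∀ e → T 1ℤ (λ v → F e (+ n ∷ v)) (staircase n) ≡ 0ℤ
T₁-tail zero          A e = refl
T₁-tail (suc zero)    A e = cong₂ (λ y z → y + z + 0ℤ) (equal A e 1ℤ []) (antipodal A e 1ℤ [])
T₁-tail (suc (suc m)) {F} A e = cong₂ _+_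
  (cong₂ _+_ (trans (cong (λ c → F e (+ suc (suc m) ∷ c ∷ staircase (suc m))) (+1≡suc (suc m))) (equal A e _ _))
             (equal (tail A) e (+ m) (staircase m)))
  (T₁-tail (suc m) (tail A) e)

-- Tensoring the trivial module with V gives V: only (1) + ρ survives. The rank is at least 2, since
-- in rank 1 both translates 1 and -1 of the entry 0 may survive.
T₁-staircase : ∀ m {F} → Alternating F → ∀ e →
  T 1ℤ (F e) (staircase (suc (suc m))) ≡ F e (+ suc (suc m) ∷ staircase (suc m))
T₁-staircase m {F} A e = trans (cong₂ _+_
  (cong₂ _+_ (cong (λ c → F e (c ∷ staircase (suc m))) (+1≡suc (suc m))) (equal A e (+ m) (staircase m)))
  (T₁-tail (suc m) A e)) (trans (ℤ.+-identityʳ _) (ℤ.+-identityʳ _))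

-- This is V ⊗ V, with the terms (2) + ρ, ρ, (1,1) + ρ and a last one. The last one repeats the
-- entry m - 1 unless `m` is 0, when it is (1,-1) + ρ.
T₁-vector : ∀ m {F} → Alternating F → ∀ e →
  T 1ℤ (F e) (+ suc (suc m) ∷ staircase (suc m)) ≡
  F e (+ suc (suc (suc m)) ∷ staircase (suc m)) + F e (staircase (suc (suc m))) +
  (F e (+ suc (suc m) ∷ + suc m ∷ staircase m) + F e (+ suc (suc m) ∷ + m - 1ℤ ∷ staircase m))
T₁-vector m {F} A e = cong₂ _+_
  (cong (λ c → F e (c ∷ staircase (suc m)) + F e (staircase (suc (suc m)))) (+1≡suc (suc (suc m))))
  (trans (cong₂ _+_
    (cong (λ c → F e (+ suc (suc m) ∷ c ∷ staircase m) + F e (+ suc (suc m) ∷ + m - 1ℤ ∷ staircase m)) (+1≡suc m))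
    (T₁-tail m (tail A) e)) (ℤ.+-identityʳ _))

-- A translate by ±2 repeats, up to sign, an entry two places away. The one exception is the entry 1
-- lowered to -1: changing its sign together with that of the final 0 is allowed in W and restores
-- the staircase.
T₂-tail : ∀ m {F} → Alternating F → ∀ e →
  T (+ 2) (λ v → F e (+ suc (suc (suc m)) ∷ + suc (suc m) ∷ v)) (staircase (suc (suc m))) ≡
  F e (staircase (suc (suc (suc (suc m)))))

T₂-tail-1 : ∀ {F} → Alternating F → ∀ e → T (+ 2) (λ v → F e (+ 2 ∷ + 1 ∷ v)) (staircase 1) ≡ 0ℤ
T₂-tail-1 A e = cong₂ (λ y z → y + z + 0ℤ) (equal₂ A e (+ 2) (+ 1) []) (antipodal₂ A e (+ 2) (+ 1) [])

T₂-tail m {F} A e = trans (cong₂ _+_ (cong₂ _+_ raised refl) refl) (lowered m A)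
  where
  raised : F e (+ suc (suc (suc m)) ∷ + suc (suc m) ∷ + suc m + + 2 ∷ staircase (suc m)) ≡ 0ℤ
  raised = trans (cong (λ c → F e (+ suc (suc (suc m)) ∷ + suc (suc m) ∷ c ∷ staircase (suc m))) (+2≡suc² (suc m)))
    (equal₂ A e _ _ _)
  lowered : ∀ m {F} → Alternating F →
    0ℤ + F e (+ suc (suc (suc m)) ∷ + suc (suc m) ∷ + suc m - + 2 ∷ staircase (suc m)) +
      T (+ 2) (λ v → F e (+ suc (suc (suc m)) ∷ + suc (suc m) ∷ + suc m ∷ v)) (staircase (suc m)) ≡
    F e (staircase (suc (suc (suc (suc m)))))
  lowered zero    {F} A = trans (cong₂ _+_ (ℤ.+-identityˡ (F e (+ 3 ∷ + 2 ∷ -1ℤ ∷ + 0 ∷ []))) (T₂-tail-1 (tail {a = + 3} A) e))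
    (trans (ℤ.+-identityʳ _) (flip₂ (tail (tail A)) e (+ 1) (+ 0) []))
  lowered (suc m) {F} A = trans (cong₂ (λ y z → 0ℤ + y + z)
    (equal₂ (tail (tail A)) e (+ m) (+ suc m) (staircase m)) (T₂-tail m (tail A) e)) (ℤ.+-identityˡ _)

-- This is p₂ = Sym² - Λ². The first entry raised gives (2) + ρ, the second one raised is a swap
-- away from (1,1) + ρ, and 1 lowered to -1 gives ρ. The cases differ in whether the entry 1 comes
-- first, second or later; for `m` equal to 0 the entry -2 yields the additional term (1,-1) + ρ.
T₂-staircase : ∀ m {F} → Alternating F → ∀ e →
  T (+ 2) (F e) (staircase (suc (suc m))) ≡
  F e (+ suc (suc (suc m)) ∷ staircase (suc m)) + F e (staircase (suc (suc m))) -
  (F e (+ suc (suc m) ∷ + suc m ∷ staircase m) + F e (+ suc (suc m) ∷ + m - 1ℤ ∷ staircase m))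
T₂-staircase zero {F} A e = trans
  (cong₂ (λ y z → F e (+ 3 ∷ + 0 ∷ []) + y + z) (flip₂ A e (+ 1) (+ 0) [])
    (cong₂ (λ y z → y + z + 0ℤ) (swap A e here)
      (trans (flip A e (there here)) (trans (swap A _ here) (cong -_ (trans (flip A _ (there here))
        (cong (λ e → F e (+ 2 ∷ -1ℤ ∷ [])) (opposite-involutive e))))))))
  (lemma (F e (+ 3 ∷ + 0 ∷ [])) (F e (+ 1 ∷ + 0 ∷ [])) (F e (+ 2 ∷ + 1 ∷ [])) (F e (+ 2 ∷ -1ℤ ∷ [])))
  where
  lemma : ∀ a b c d → a + b + (- c + (- d) + 0ℤ) ≡ a + b - (c + d)
  lemma = solve-∀
T₂-staircase (suc zero) {F} A e = trans
  (cong₂ (λ y z → F e (+ 4 ∷ + 1 ∷ + 0 ∷ []) + y + z) (equal₂ A e (+ 0) (+ 1) [])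
    (cong₂ _+_ (cong₂ _+_ (swap A e here) (flip₂ (tail A) e (+ 1) (+ 0) [])) (T₂-tail-1 A e)))
  (trans (lemma (F e (+ 4 ∷ + 1 ∷ + 0 ∷ [])) (F e (+ 2 ∷ + 1 ∷ + 0 ∷ [])) (F e (+ 3 ∷ + 2 ∷ + 0 ∷ [])))
    (cong (λ z → F e (+ 4 ∷ + 1 ∷ + 0 ∷ []) + F e (+ 2 ∷ + 1 ∷ + 0 ∷ []) - (F e (+ 3 ∷ + 2 ∷ + 0 ∷ []) + z))
      (sym (equal (tail A) e (+ 0) []))))
  where
  lemma : ∀ a b c → a + 0ℤ + (- c + b + 0ℤ) ≡ a + b - (c + 0ℤ)
  lemma = solve-∀
T₂-staircase (suc (suc p)) {F} A e = begin
  F e (+ suc m + + 2 ∷ staircase (suc m)) + F e (+ suc p ∷ + m ∷ + suc p ∷ staircase (suc p)) +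
    (F e (+ suc m ∷ + m + + 2 ∷ staircase m) + F e (+ suc m ∷ + p ∷ + suc p ∷ + p ∷ staircase p) +
      T (+ 2) (λ v → F e (+ suc m ∷ + m ∷ v)) (staircase m))
    ≡⟨ cong₂ _+_ (cong₂ _+_ (cong (λ c → F e (c ∷ staircase (suc m))) (+2≡suc² (suc m))) (equal₂ A e (+ suc p) (+ m) _))
        (cong₂ _+_ (cong₂ _+_ (trans (cong (λ c → F e (+ suc m ∷ c ∷ staircase m)) (+2≡suc² m)) (swap A e here))
          (equal₂ (tail A) e (+ p) (+ suc p) _)) (T₂-tail p A e)) ⟩
  a + 0ℤ + (- c + 0ℤ + b)
    ≡⟨ lemma a b c ⟩
  a + b - (c + 0ℤ)
    ≡⟨ cong (λ z → a + b - (c + z)) (sym (equal (tail A) e (+ suc p) _)) ⟩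
  a + b - (c + F e (+ suc (suc m) ∷ + m - 1ℤ ∷ staircase m)) ∎
  where
  open ≡-Reasoning
  m = suc (suc p)
  a = F e (+ suc (suc (suc m)) ∷ staircase (suc m))
  b = F e (staircase (suc (suc m)))
  c = F e (+ suc (suc m) ∷ + suc m ∷ staircase m)
  lemma : ∀ a b c → a + 0ℤ + (- c + 0ℤ + b) ≡ a + b - (c + 0ℤ)
  lemma = solve-∀

-- Recursion on the rank

expand-zero : ∀ {n} {g : ℤ → Weight n → ℤ} {x} → VAll.All (λ c → ∀ v → g c v ≡ 0ℤ) x → expand g x ≡ 0ℤ
expand-zero {zero}  (p ∷ []) = p []
expand-zero {suc n} {x = a ∷ x} (p ∷ ps) = cong₂ _-_ (p x) (expand-zero (VAll.map (λ q v → q (a ∷ v)) ps))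

expand-first : ∀ {n} {g : ℤ → Weight n → ℤ} {a x} → VAll.All (λ c → ∀ v → g c v ≡ 0ℤ) x → expand g (a ∷ x) ≡ g a x
expand-first {zero}  {x = []} [] = refl
expand-first {suc n} {g} {a} {x} ps =
  trans (cong (λ z → g a x - z) (expand-zero (VAll.map (λ q v → q (a ∷ v)) ps))) (ℤ.+-identityʳ (g a x))

Alt-zero : ∀ {n} e {f : Weight n → ℤ} → (∀ u → f u ≡ 0ℤ) → ∀ x → Alt e f x ≡ 0ℤ
Alt-zero {zero}  Sign.+ eq [] = eq []
Alt-zero {zero}  Sign.- eq [] = refl
Alt-zero {suc n} e      eq x  = expand-zero (VAll.universal (λ c v →
  cong₂ _+_ (Alt-zero e (λ u → eq (c ∷ u)) v) (Alt-zero (Sign.opposite e) (λ u → eq (- c ∷ u)) v)) x)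

Below : ∀ {n} → ℕ → Weight n → Set
Below b = VAll.All (λ c → ℤ.∣ c ∣ ℕ.< b)

below-staircase : ∀ {n b} → n ℕ.≤ b → Below b (staircase n)
below-staircase {zero}  n≤b = []
below-staircase {suc n} n≤b = n≤b ∷ below-staircase (ℕ.<⇒≤ n≤b)

below⇒negative : ∀ c {b} → ℤ.∣ c ∣ ℕ.< b → c - + b ℤ.< 0ℤ
below⇒negative c {b} c<b = subst (c - + b ℤ.<_) (ℤ.+-inverseʳ (+ b)) (ℤ.+-monoˡ-< (- + b) (c<+b c c<b))
  where
  c<+b : ∀ c → ℤ.∣ c ∣ ℕ.< b → c ℤ.< + b
  c<+b (+ m)    m<b = ℤ.+<+ m<b
  c<+b -[1+ m ] _   = ℤ.-<+

negative-difference : ∀ a b → - + a - + suc b ℤ.< 0ℤ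
negative-difference zero    b = ℤ.-<+
negative-difference (suc a) b = ℤ.-<+

-- The part of `D` in which `c` or `- c` is moved to the front, where it is compared with the first
-- coordinate `b` of μ + ρ.
slice : ∀ {n} → ℕ → Weight n → ℕ → ℤ → Weight n → ℤ
slice b y k c v = Alt Sign.+ (λ u → 𝒫 (c - + b ∷ u ⊟ y) k) v + Alt Sign.- (λ u → 𝒫 (- c - + b ∷ u ⊟ y) k) v

slice-below : ∀ {n} b (y : Weight n) k {c} → ℤ.∣ c ∣ ℕ.< b → ∀ v → slice b y k c v ≡ 0ℤ
slice-below b y k {c} c<b v = cong₂ _+_
  (Alt-zero Sign.+ (λ u → 𝒫-neg (below⇒negative c c<b) (u ⊟ y) k) v)
  (Alt-zero Sign.- (λ u → 𝒫-neg (below⇒negative (- c) (subst (ℕ._< b) (sym (ℤ.∣-i∣≡∣i∣ c)) c<b)) (u ⊟ y) k) v)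

slice-above : ∀ {n} j b (y : Weight n) k v →
  slice (suc b) y k (+ (j ℕ.+ suc b)) v ≡ Alt Sign.+ (λ u → 𝒫 (+ j ∷ u ⊟ y) k) v
slice-above j b y k v = trans (cong₂ _+_
  (cong (λ c → Alt Sign.+ (λ u → 𝒫 (c ∷ u ⊟ y) k) v) (cancel (+ j) (+ suc b)))
  (Alt-zero Sign.- (λ u → 𝒫-neg (negative-difference (j ℕ.+ suc b) b) (u ⊟ y) k) v)) (ℤ.+-identityʳ _)
  where
  cancel : ∀ i j → i + j - j ≡ i
  cancel = solve-∀

-- Any other entry, or the first one negated, would make the leading coordinate of the difference
-- negative. Writing `suc b` excludes 0, where a negated entry need not fall below.
D-first : ∀ {n} j b {x : Weight n} → Below (suc b) x → ∀ y k →
  D (+ (j ℕ.+ suc b) ∷ x) (+ suc b ∷ y) k ≡ Alt Sign.+ (λ u → 𝒫 (+ j ∷ u ⊟ y) k) x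
D-first j b {x} x<b y k =
  trans (expand-first (VAll.map (λ {c} → slice-below (suc b) y k {c}) x<b)) (slice-above j b y k x)

D-below : ∀ {n} b {x : Weight (suc n)} → Below b x → ∀ y k → D x (+ b ∷ y) k ≡ 0ℤ
D-below b x<b y k = expand-zero (VAll.map (λ {c} → slice-below b y k {c}) x<b)

level-0 : ∀ {n} (x y : Weight n) k → Alt Sign.+ (λ u → 𝒫 (+ 0 ∷ u ⊟ y) k) x ≡ D x y k
level-0 x y k = Alt-cong Sign.+ (λ u → 𝒫-0 (u ⊟ y) k) x

level-1 : ∀ {n} (x y : Weight n) k →
  Alt Sign.+ (λ u → 𝒫 (+ 1 ∷ u ⊟ y) k) x ≡ shift (λ k → T 1ℤ (λ z → D z y k) x) k
level-1         x y zero    = Alt-zero Sign.+ (λ u → 𝒫-1 (u ⊟ y) 0) x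
level-1 {n}     x y (suc k) = trans (Alt-cong Sign.+ (λ u → trans (𝒫-1 (u ⊟ y) (suc k))
    (trans (∑-cong (λ w → cong (λ z → 𝒫 z k) (⊟-swap u y w)) (units n)) (∑-units-T (λ v → 𝒫 (v ⊟ y) k) u))) x)
  (Alt-T Sign.+ 1ℤ (λ v → 𝒫 (v ⊟ y) k) x)

-- The alternating sum with h₂ applied. Only its double is expressed by translations, and `halve`
-- recovers it for the staircase.
half-level-2 : ∀ {n} → Weight n → Weight n → Series
half-level-2 {n} x y k = Alt Sign.+ (λ u → pairSum (λ γ → 𝒫 γ k) (units n) (u ⊟ y)) x

level-2 : ∀ {n} (x y : Weight n) k →
  Alt Sign.+ (λ u → 𝒫 (+ 2 ∷ u ⊟ y) k) x ≡ shift (shift (half-level-2 x y)) k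
level-2 x y zero          = Alt-zero Sign.+ (λ u → 𝒫-2 (u ⊟ y) 0) x
level-2 x y (suc zero)    = Alt-zero Sign.+ (λ u → 𝒫-2 (u ⊟ y) 1) x
level-2 x y (suc (suc k)) = Alt-cong Sign.+ (λ u → 𝒫-2 (u ⊟ y) (suc (suc k))) x

double-half-level-2 : ∀ {n} (x y : Weight n) k →
  half-level-2 x y k + half-level-2 x y k ≡ T 1ℤ (T 1ℤ (λ z → D z y k)) x + T (+ 2) (λ z → D z y k) x
double-half-level-2 {n} x y k = begin
  Alt Sign.+ h x + Alt Sign.+ h x
    ≡⟨ Alt-+ Sign.+ h h x ⟨
  Alt Sign.+ (λ u → h u + h u) x
    ≡⟨ Alt-cong Sign.+ (λ u → trans (double-pairSum (λ γ → 𝒫 γ k) (units n) (u ⊟ y)) (cong₂ _+_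
        (trans (∑-cong (λ w → trans (∑-cong (λ w′ → cong (λ z → 𝒫 z k) (⊟-swap₂ u w w′)) (units n))
            (∑-units-T f (u ⊟ w))) (units n)) (∑-units-T (T 1ℤ f) u))
        (trans (∑-cong (λ w → cong (λ z → 𝒫 z k) (⊟-swap₂ u w w)) (units n)) (∑-units-T₂ f u)))) x ⟩
  Alt Sign.+ (λ u → T 1ℤ (T 1ℤ f) u + T (+ 2) f u) x
    ≡⟨ Alt-+ Sign.+ (T 1ℤ (T 1ℤ f)) (T (+ 2) f) x ⟩
  Alt Sign.+ (T 1ℤ (T 1ℤ f)) x + Alt Sign.+ (T (+ 2) f) x
    ≡⟨ cong₂ _+_ (trans (Alt-T Sign.+ 1ℤ (T 1ℤ f) x) (T-cong 1ℤ (Alt-T Sign.+ 1ℤ f) x)) (Alt-T Sign.+ (+ 2) f x) ⟩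
  T 1ℤ (T 1ℤ (Alt Sign.+ f)) x + T (+ 2) (Alt Sign.+ f) x ∎
  where
  open ≡-Reasoning
  f = λ v → 𝒫 (v ⊟ y) k
  h = λ u → pairSum (λ γ → 𝒫 γ k) (units n) (u ⊟ y)
  ⊟-swap₂ : ∀ u w w′ → u ⊟ y ⊟ w ⊟ w′ ≡ u ⊟ w ⊟ w′ ⊟ y
  ⊟-swap₂ u w w′ = trans (cong (_⊟ w′) (⊟-swap u y w)) (⊟-swap (u ⊟ w) y w′)

-- Two entries are large enough for the front: the first with difference 1, the second with
-- difference 0 and the sign -1 of its place. The second one is the source of the subtracted A(n) in
-- the recursion for B.
D-two-terms : ∀ {n} b {x : Weight n} → Below (suc b) x → ∀ y k →
  D (+ suc (suc b) ∷ + suc b ∷ x) (+ suc b ∷ y) k ≡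
  shift (λ k → T 1ℤ (λ z → D z y k) (+ suc b ∷ x)) k - D (+ suc (suc b) ∷ x) y k
D-two-terms b {x} x<b y k = cong₂ _-_
  (trans (slice-above 1 b y k (+ suc b ∷ x)) (level-1 (+ suc b ∷ x) y k))
  (trans (expand-first (VAll.map (λ {c} c<b v → slice-below (suc b) y k {c} c<b (+ suc (suc b) ∷ v)) x<b))
    (trans (slice-above 0 b y k (+ suc (suc b) ∷ x)) (level-0 (+ suc (suc b) ∷ x) y k)))

D-peel : ∀ {n} b {x : Weight n} → Below (suc b) x → ∀ y → D (+ suc b ∷ x) (+ suc b ∷ y) ≗ D x y
D-peel b {x} x<b y k = trans (D-first 0 b x<b y k) (level-0 x y k)

D-staircase : ∀ n → D (staircase n) (staircase n) ≗ 𝟙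
D-staircase zero          k = refl
-- The entry 0 is out of reach of `D-peel`: its negative also has difference 0, but that term needs
-- an odd number of sign changes in rank 0 and is 0.
D-staircase (suc zero)    k = ℤ.+-identityʳ (𝟙 k)
D-staircase (suc (suc m)) k =
  trans (D-peel m (below-staircase ℕ.≤-refl) (staircase (suc m)) k) (D-staircase (suc m) k)

D-alternating : ∀ {n} (y : Weight n) k → Alternating (λ e → Alt e (λ v → 𝒫 (v ⊟ y) k))
D-alternating y k = Alt-alternating (λ v → 𝒫 (v ⊟ y) k)

-- sym² m is K for (2) and ∅ in rank m + 1. ext² m is K for (1,1) and ∅ in rank
-- m + 2, to which for m = 0 the value at (1,-1) is added: only in rank 2 does
-- the exterior square of the vector representation split.
sym² : ℕ → Series
sym² zero    = 𝟘
sym² (suc m) = shift (shift (λ k → sym² m k + 𝟙 k))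

ext² : ℕ → Series
ext² m k = D (+ suc (suc m) ∷ + suc m ∷ staircase m) (staircase (suc (suc m))) k +
           D (+ suc (suc m) ∷ + m - 1ℤ ∷ staircase m) (staircase (suc (suc m))) k

halve : ∀ {i j} → i + i ≡ j + j → i ≡ j
halve {i} {j} eq = ℤ.i-j≡0⇒i≡j i j (i≡-i⇒i≡0 (trans (lemma₁ i j) (trans (cong (λ z → z - (i + j)) eq) (lemma₂ i j))))
  where
  lemma₁ : ∀ i j → i - j ≡ i + i - (i + j)
  lemma₁ = solve-∀
  lemma₂ : ∀ i j → j + j - (i + j) ≡ - (i - j)
  lemma₂ = solve-∀

-- The induction statement h₂ = V(2) + 1 in rank m + 1. It is named so that its consequences in rank
-- m + 2 can be used inside the induction itself.
HalfLevel2 : ℕ → Set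
HalfLevel2 m = half-level-2 (staircase (suc m)) (staircase (suc m)) ≗ (λ k → sym² m k + 𝟙 k)

module _ m (half : HalfLevel2 m) where

  -- `b = m` is the case of (2) and ∅, `b = suc m` that of (3) and (1): a common increase of the
  -- first parts changes nothing.
  D-level-2 : ∀ {b} → m ℕ.≤ b →
    D (+ suc (suc (suc b)) ∷ staircase (suc m)) (+ suc b ∷ staircase (suc m)) ≗ sym² (suc m)
  D-level-2 {b} m≤b k = trans (D-first 2 b (below-staircase (ℕ.s≤s m≤b)) (staircase (suc m)) k)
    (trans (level-2 (staircase (suc m)) (staircase (suc m)) k) (shift-cong (shift-cong half) k))

  T₁-vector-staircase : ∀ k →
    T 1ℤ (λ z → D z (staircase (suc (suc m))) k) (+ suc (suc m) ∷ staircase (suc m)) ≡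
    sym² (suc m) k + 𝟙 k + ext² m k
  T₁-vector-staircase k = trans (T₁-vector m (D-alternating (staircase (suc (suc m))) k) Sign.+)
    (cong₂ (λ y z → y + z + ext² m k) (D-level-2 ℕ.≤-refl k) (D-staircase (suc (suc m)) k))

-- In p₁² + p₂ the two copies of `ext²` have opposite signs and cancel. The value at (2) + ρ comes
-- from one rank below, because its first coordinate exceeds that of ρ by 2.
half-level-2-staircase : ∀ m → HalfLevel2 m
-- Rank 1 has no roots: two unit steps return to 0 in two ways, and a step of length 2 contributes
-- nothing.
half-level-2-staircase zero    k = halve (trans (double-half-level-2 (+ 0 ∷ []) (+ 0 ∷ []) k) (lemma (𝟙 k)))
  where
  lemma : ∀ z → 0ℤ + 0ℤ + (z + 0ℤ) + 0ℤ + (z + 0ℤ + (0ℤ + 0ℤ) + 0ℤ) + 0ℤ + (0ℤ + 0ℤ + (0ℤ + 0ℤ) + 0ℤ) ≡ 0ℤ + z + (0ℤ + z)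
  lemma = solve-∀
half-level-2-staircase (suc m) k = halve (begin
  half-level-2 st st k + half-level-2 st st k
    ≡⟨ double-half-level-2 st st k ⟩
  T 1ℤ (T 1ℤ E) st + T (+ 2) E st
    ≡⟨ cong₂ _+_
        (trans (T₁-staircase m (T-alternating 1ℤ (λ v → 𝒫 (v ⊟ st) k)) Sign.+) (T₁-vector-staircase m half k))
        (trans (T₂-staircase m (D-alternating st k) Sign.+)
          (cong₂ (λ y z → y + z - ext² m k) (D-level-2 m half ℕ.≤-refl k) (D-staircase (suc (suc m)) k))) ⟩
  sym² (suc m) k + 𝟙 k + ext² m k + (sym² (suc m) k + 𝟙 k - ext² m k)
    ≡⟨ lemma (sym² (suc m) k) (𝟙 k) (ext² m k) ⟩
  sym² (suc m) k + 𝟙 k + (sym² (suc m) k + 𝟙 k) ∎)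
  where
  open ≡-Reasoning
  st = staircase (suc (suc m))
  E  = λ z → D z st k
  half = half-level-2-staircase m
  lemma : ∀ a e b → a + e + b + (a + e - b) ≡ a + e + (a + e)
  lemma = solve-∀

D-sym² : ∀ m → D (+ suc (suc m) ∷ staircase m) (staircase (suc m)) ≗ sym² m
D-sym² zero    k = refl
D-sym² (suc m) k = D-level-2 m (half-level-2-staircase m) ℕ.≤-refl k

-- `q` times the contribution of V ⊗ V in rank m + 2; this is K for (2,1) and (1) in rank m + 3.
vector² : ℕ → Series
vector² m = shift (λ k → sym² (suc m) k + 𝟙 k + ext² m k)

D-ext²-suc : ∀ m → D (+ suc (suc (suc m)) ∷ + suc (suc m) ∷ staircase (suc m)) (staircase (suc (suc (suc m)))) ≗
  vector² m ⊖ sym² (suc m)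
D-ext²-suc m k = trans (D-two-terms (suc m) (below-staircase (ℕ.n≤1+n (suc m))) (staircase (suc (suc m))) k)
  (cong₂ _-_ (shift-cong (T₁-vector-staircase m (half-level-2-staircase m)) k) (D-sym² (suc m) k))

ext²-suc : ∀ m → ext² (suc m) ≗ vector² m ⊖ sym² (suc m)
ext²-suc m k = trans (cong₂ _+_ (D-ext²-suc m k)
  (equal (tail (D-alternating (staircase (suc (suc (suc m)))) k)) Sign.+ (+ m) (staircase m))) (ℤ.+-identityʳ _)

-- The root system in rank 2 is A₁ × A₁, and (1,1) and (1,-1) are its two positive roots; each
-- contributes `q`.
ext²-zero : ∀ k → ext² 0 k ≡ shift 𝟙 k + shift 𝟙 k
ext²-zero k = cong₂ _+_
  (trans (D-two-terms 0 [] (+ 0 ∷ []) k)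
    (trans (ℤ.+-identityʳ _) (shift-cong (λ k → lemma₁ (𝟙 k)) k)))
  (trans (cong₂ _-_
    (trans (slice-above 1 0 (+ 0 ∷ []) k (-1ℤ ∷ [])) (trans (level-1 (-1ℤ ∷ []) (+ 0 ∷ []) k) (shift-cong (λ k → lemma₂ (𝟙 k)) k)))
    -- The entry -1 reaches 1 only by a sign change, which leaves the odd sum in rank 1; it vanishes
    -- at the entry 2.
    (cong₂ _+_ (Alt-zero Sign.+ (λ u → 𝒫-neg (ℤ.-<+ {1}) (u ⊟ (+ 0 ∷ [])) k) (+ 2 ∷ []))
      (Alt-cong Sign.- (λ u → 𝒫-0 (u ⊟ (+ 0 ∷ [])) k) (+ 2 ∷ []))))
    (ℤ.+-identityʳ _))
  where
  lemma₁ : ∀ z → 0ℤ + 0ℤ + (z + 0ℤ) + 0ℤ ≡ z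
  lemma₁ = solve-∀
  lemma₂ : ∀ z → z + 0ℤ + (0ℤ + 0ℤ) + 0ℤ ≡ z
  lemma₂ = solve-∀

-- Vanishing by parity

total : ∀ {n} → Weight n → ℤ
total []      = 0ℤ
total (b ∷ β) = b + total β

Even : ℤ → Set
Even z = + 2 ∣ z

total-0ʷ : ∀ n → total (0ʷ {n}) ≡ 0ℤ
total-0ʷ zero    = refl
total-0ʷ (suc n) = trans (ℤ.+-identityˡ _) (total-0ʷ n)

total-⊞ : ∀ {n} (β γ : Weight n) → total (β ⊞ γ) ≡ total β + total γ
total-⊞ []      []      = refl
total-⊞ (b ∷ β) (c ∷ γ) = trans (cong (λ z → b + c + z) (total-⊞ β γ)) (lemma b c (total β) (total γ))
  where
  lemma : ∀ a b c d → a + b + (c + d) ≡ a + c + (b + d)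
  lemma = solve-∀

total-⊟ : ∀ {n} (β γ : Weight n) → total (β ⊟ γ) ≡ total β - total γ
total-⊟ []      []      = refl
total-⊟ (b ∷ β) (c ∷ γ) = trans (cong (λ z → b - c + z) (total-⊟ β γ)) (lemma b c (total β) (total γ))
  where
  lemma : ∀ a b c d → a - b + (c - d) ≡ a + c - (b + d)
  lemma = solve-∀

total-unit : ∀ {n} {w : Weight n} → IsUnit w → total w ≡ 1ℤ ⊎ total w ≡ -1ℤ
total-unit {suc n} (here +1 refl) = inj₁ (cong (λ z → 1ℤ + z) (total-0ʷ n))
total-unit {suc n} (here −1 refl) = inj₂ (cong (λ z → -1ℤ + z) (total-0ʷ n))
total-unit {w = _ ∷ w} (there u) with total-unit u
... | inj₁ eq = inj₁ (trans (ℤ.+-identityˡ (total w)) eq)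
... | inj₂ eq = inj₂ (trans (ℤ.+-identityˡ (total w)) eq)

even-root : ∀ {n} {α : Weight n} → IsRoot α → Even (total α)
even-root {α = _ ∷ α} (there p) = subst Even (sym (ℤ.+-identityˡ (total α))) (even-root p)
even-root (here ±1 u) with ±1 | total-unit u
... | +1 | inj₁ eq = divides (+ 1) (cong (λ z → 1ℤ + z) eq)
... | +1 | inj₂ eq = divides (+ 0) (cong (λ z → 1ℤ + z) eq)
... | −1 | inj₁ eq = divides (+ 0) (cong (λ z → -1ℤ + z) eq)
... | −1 | inj₂ eq = divides -1ℤ (cong (λ z → -1ℤ + z) eq)

divide-odd : ∀ {n} {αs : List (Weight n)} → All (Even ∘ total) αs →
  ∀ β k → ¬ Even (total β) → divide αs one β k ≡ 0ℤ
divide-odd {n} [] β k odd rewrite dec-false (β ≟ʷ 0ʷ)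
  (λ β≡0 → odd (subst Even (sym (trans (cong total β≡0) (total-0ʷ n))) (divides 0ℤ refl))) = refl
divide-odd (p ∷ ps) β zero    odd = divide-odd ps β zero odd
divide-odd {αs = α ∷ _} (p ∷ ps) β (suc k) odd = cong₂ _+_ (divide-odd ps β (suc k) odd)
  (divide-odd (p ∷ ps) (β ⊟ α) k λ even → odd (subst Even
    (trans (cong (λ z → z + total α) (total-⊟ β α)) (lemma (total β) (total α))) (∣.∣m∣n⇒∣m+n even p)))
  where
  lemma : ∀ a b → a - b + b ≡ a
  lemma = solve-∀

𝒫-odd : ∀ {n} (β : Weight n) k → ¬ Even (total β) → 𝒫 β k ≡ 0ℤ
𝒫-odd {n} β k odd = trans (cong (λ αs → divide αs one β k) (positiveRoots≡roots n))
  (divide-odd (All.map even-root (roots-areRoots n)) β k odd)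

expand-total : ∀ {n} {g : ℤ → Weight n → ℤ} x → (∀ c v → c + total v ≡ total x → g c v ≡ 0ℤ) → expand g x ≡ 0ℤ
expand-total {zero}  (a ∷ []) zeros = zeros a [] refl
expand-total {suc n} (a ∷ x)  zeros = cong₂ _-_ (zeros a x refl)
  (expand-total x (λ c v eq → zeros c (a ∷ v) (trans (lemma c a (total v)) (cong (λ z → a + z) eq))))
  where
  lemma : ∀ a b c → a + (b + c) ≡ b + (a + c)
  lemma = solve-∀

-- Permuting preserves the coordinate sum and negating an entry `c` changes it by -2c, so `f` is
-- evaluated only where the sums differ by an even number.
Alt-parity : ∀ {n} e {f : Weight n → ℤ} x → (∀ u → Even (total u - total x) → f u ≡ 0ℤ) → Alt e f x ≡ 0ℤ
Alt-parity {zero}  Sign.+ [] zeros = zeros [] (divides 0ℤ refl)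
Alt-parity {zero}  Sign.- [] zeros = refl
Alt-parity {suc n} e      x  zeros = expand-total x (λ c v eq → cong₂ _+_
  (Alt-parity e v (λ u even → zeros (c ∷ u)
    (subst Even (trans (same (total u) (total v) c) (cong (λ z → c + total u - z) eq)) even)))
  (Alt-parity (Sign.opposite e) v (λ u even → zeros (- c ∷ u)
    (subst Even (trans (flipped (total u) (total v) c) (cong (λ z → - c + total u - z) eq))
      (∣.∣m∣n⇒∣m+n even (divides (- c) refl))))))
  where
  same : ∀ u v c → u - v ≡ c + u - (c + v)
  same = solve-∀
  flipped : ∀ u v c → u - v + - c * + 2 ≡ - c + u - (c + v)
  flipped = solve-∀

K-odd : ∀ {n} (lam mu : Weight n) → ¬ Even (total lam - total mu) → K lam mu ≗ 𝟘
K-odd {n} lam mu odd k = trans (K≗D lam mu k) (Alt-parity Sign.+ (lam ⊞ ρ n) λ u even →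
  𝒫-odd (u ⊟ (mu ⊞ ρ n)) k λ even′ → odd (subst Even (begin
    total (u ⊟ (mu ⊞ ρ n)) - (total u - total (lam ⊞ ρ n))
      ≡⟨ cong₂ (λ y z → y - (total u - z)) (trans (total-⊟ u (mu ⊞ ρ n)) (cong (λ z → total u - z) (total-⊞ mu (ρ n))))
          (total-⊞ lam (ρ n)) ⟩
    total u - (total mu + total (ρ n)) - (total u - (total lam + total (ρ n)))
      ≡⟨ lemma (total u) (total lam) (total mu) (total (ρ n)) ⟩
    total lam - total mu ∎) (∣.∣m∣n⇒∣m-n even′ even)))
  where
  open ≡-Reasoning
  lemma : ∀ u l m r → u - (m + r) - (u - (l + r)) ≡ l - m
  lemma = solve-∀

total-weight : ∀ {n} as → length as ≤ n → total (weight n as) ≡ + sum as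
total-weight {zero}  []       _       = refl
total-weight {suc n} []       _       = trans (ℤ.+-identityˡ _) (total-weight {n} [] z≤n)
total-weight {suc n} (a ∷ as) (s≤s p) = cong (λ z → + a + z) (total-weight as p)

K-odd-weight : ∀ {n} as bs → ¬ Even (+ sum as - + sum bs) → length as ≤ n → length bs ≤ n →
  K (weight n as) (weight n bs) ≗ 𝟘
K-odd-weight {n} as bs odd p q =
  K-odd (weight n as) (weight n bs) (odd ∘ subst Even (cong₂ _-_ (total-weight as p) (total-weight bs q)))

-- Closed forms

⊛-congʳ : ∀ F {G G′} → G ≗ G′ → F ⊛ G ≗ F ⊛ G′
⊛-congʳ F eq k = ∑-cong (λ i → cong (F i *_) (eq (k ∸ i))) (upTo (suc k))

⊛-distribʳ-⊖ : ∀ F G H → (F ⊖ G) ⊛ H ≗ F ⊛ H ⊖ G ⊛ H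
⊛-distribʳ-⊖ F G H k = go (upTo (suc k))
  where
  lemma : ∀ f g h s t → (f - g) * h + (s - t) ≡ f * h + s - (g * h + t)
  lemma = solve-∀
  go : ∀ is → ∑ (λ i → (F i - G i) * H (k ∸ i)) is ≡ ∑ (λ i → F i * H (k ∸ i)) is - ∑ (λ i → G i * H (k ∸ i)) is
  go []       = refl
  go (i ∷ is) = trans (cong (λ z → (F i - G i) * H (k ∸ i) + z) (go is)) (lemma (F i) (G i) (H (k ∸ i)) _ _)

upTo-suc : ∀ k → upTo (suc k) ≡ 0 ∷ List.map suc (upTo k)
upTo-suc k = cong (0 ∷_) (sym (List.map-applyUpTo id suc k))

shift-⊛ : ∀ m F → q^ suc m ⊛ F ≗ shift (q^ m ⊛ F)
shift-⊛ m F zero    = refl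
shift-⊛ m F (suc k) = trans (cong (∑ (λ i → (q^ suc m) i * F (suc k ∸ i))) (upTo-suc (suc k)))
  (trans (ℤ.+-identityˡ _) (∑-map (λ i → (q^ suc m) i * F (suc k ∸ i)) suc (upTo (suc k))))

𝟙-⊛ : ∀ F → 𝟙 ⊛ F ≗ F
𝟙-⊛ F k = trans (cong (∑ (λ i → 𝟙 i * F (k ∸ i))) (upTo-suc k))
  (trans (cong₂ _+_ (ℤ.*-identityˡ (F k)) (trans (∑-map (λ i → 𝟙 i * F (k ∸ i)) suc (upTo k)) (zeros (upTo k))))
    (ℤ.+-identityʳ (F k)))
  where
  zeros : ∀ (is : List ℕ) → ∑ (λ i → 0ℤ * F (k ∸ suc i)) is ≡ 0ℤ
  zeros []       = refl
  zeros (i ∷ is) = trans (ℤ.+-identityˡ _) (zeros is)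

q¹-⊛ : ∀ F → q^ 1 ⊛ F ≗ shift F
q¹-⊛ F k = trans (shift-⊛ 0 F k) (shift-cong (𝟙-⊛ F) k)

q²-⊛ : ∀ F → q^ 2 ⊛ F ≗ shift (shift F)
q²-⊛ F k = trans (shift-⊛ 1 F k) (shift-cong (q¹-⊛ F) k)

-- `sym² m` is the geometric sum q² + q⁴ + ⋯ + q^(2m), which telescopes under q² - 1.
sym²-closed : ∀ m k → shift (shift (sym² m)) k - sym² m k ≡ shift (shift (q^ (2 ℕ.* m) ⊖ 𝟙)) k
sym²-closed zero    zero          = refl
sym²-closed zero    (suc zero)    = refl
sym²-closed zero    (suc (suc k)) = sym (ℤ.+-inverseʳ (𝟙 k))
sym²-closed (suc m) k = trans (go k) (cong (λ e → shift (shift (q^ e ⊖ 𝟙)) k) (sym (ℕ.*-suc 2 m)))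
  where
  IH = sym²-closed m
  lemma₀ : ∀ a → 0ℤ - (a + 1ℤ) ≡ 0ℤ - a - 1ℤ
  lemma₀ = solve-∀
  lemma₁ : ∀ a → 0ℤ - (a + 0ℤ) ≡ 0ℤ - a
  lemma₁ = solve-∀
  lemma₂ : ∀ a b e → a + e - (b + 0ℤ) ≡ a - b + e
  lemma₂ = solve-∀
  lemma₃ : ∀ a e → a - e + e ≡ a - 0ℤ
  lemma₃ = solve-∀
  go : ∀ k → shift (shift (sym² (suc m))) k - sym² (suc m) k ≡ shift (shift (q^ (2 ℕ.+ 2 ℕ.* m) ⊖ 𝟙)) k
  go zero                      = refl
  go (suc zero)                = refl
  go (suc (suc zero))          = trans (lemma₀ (sym² m 0)) (cong (λ z → z - 1ℤ) (IH 0))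
  go (suc (suc (suc zero)))    = trans (lemma₁ (sym² m 1)) (IH 1)
  go (suc (suc (suc (suc k)))) = trans (lemma₂ (sym² m k) (sym² m (suc (suc k))) (𝟙 k))
    (trans (cong (λ z → z + 𝟙 k) (IH (suc (suc k)))) (lemma₃ ((q^ (2 ℕ.* m)) k) (𝟙 k)))

-- This is 1 + q + ⋯ + q^(2m+2).
segment : ℕ → Series
segment m k = sym² (suc m) k + 𝟙 k + ext² m k - (q^ suc m) k

segment-zero : ∀ k → segment 0 k ≡ shift (shift 𝟙) k + shift 𝟙 k + 𝟙 k
segment-zero k = trans (cong (λ z → sym² 1 k + 𝟙 k + z - (q^ 1) k) (ext²-zero k)) (go k)
  where
  lemma : ∀ a → 0ℤ + a + 0ℤ + (0ℤ + 0ℤ) - 0ℤ ≡ a + 0ℤ + 0ℤ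
  lemma = solve-∀
  go : ∀ k → sym² 1 k + 𝟙 k + (shift 𝟙 k + shift 𝟙 k) - (q^ 1) k ≡ shift (shift 𝟙) k + shift 𝟙 k + 𝟙 k
  go zero          = refl
  go (suc zero)    = refl
  go (suc (suc k)) = lemma (𝟙 k)

-- With S = `sym² (suc m)`, the next `sym²` supplies q²S + q² and the next `ext²` supplies -S. By
-- `sym²-closed` they add up to q^(2m+4), the new top term.
segment-suc : ∀ m k → segment (suc m) k ≡ shift (segment m) k + 𝟙 k + (q^ (4 ℕ.+ 2 ℕ.* m)) k
segment-suc m k = trans (cong (λ z → sym² (suc (suc m)) k + 𝟙 k + z - (q^ suc (suc m)) k) (ext²-suc m k)) (go k)
  where
  S = sym² (suc m)
  E = ext² m
  Q = q^ (2 ℕ.+ 2 ℕ.* m)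
  closed : ∀ k → S k - S (suc (suc k)) ≡ Q k - 𝟙 k
  closed k = trans (sym²-closed (suc m) (suc (suc k))) (cong (λ e → (q^ e) k - 𝟙 k) (ℕ.*-suc 2 m))
  lemma₁ : ∀ a b → 0ℤ + 0ℤ + (a + 1ℤ + b - 0ℤ) - 0ℤ ≡ a + 1ℤ + b - 0ℤ + 0ℤ + 0ℤ
  lemma₁ = solve-∀
  lemma₂ : ∀ s₀ s₁ s₂ e b q → s₀ + e + 0ℤ + (s₁ + 0ℤ + b - s₂) - q ≡ s₁ + 0ℤ + b - q + 0ℤ + (s₀ - s₂ + e)
  lemma₂ = solve-∀
  lemma₃ : ∀ a e → a - e + e ≡ a
  lemma₃ = solve-∀
  go : ∀ k → sym² (suc (suc m)) k + 𝟙 k + (shift (λ k → S k + 𝟙 k + E k) k - S k) - (q^ suc (suc m)) k ≡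
    shift (segment m) k + 𝟙 k + (q^ (4 ℕ.+ 2 ℕ.* m)) k
  go zero          = refl
  go (suc zero)    = lemma₁ (S 0) (E 0)
  go (suc (suc k)) = trans (lemma₂ (S k) (S (suc k)) (S (suc (suc k))) (𝟙 k) (E (suc k)) ((q^ suc m) (suc k)))
    (cong (λ z → segment m (suc k) + 0ℤ + z) (trans (cong (λ z → z + 𝟙 k) (closed k)) (lemma₃ (Q k) (𝟙 k))))

segment-closed : ∀ m k → shift (segment m) k - segment m k ≡ (q^ (3 ℕ.+ 2 ℕ.* m)) k - 𝟙 k
segment-closed zero k = trans (cong₂ _-_ (shift-cong segment-zero k) (segment-zero k)) (go k)
  where
  G : Series
  G k = shift (shift 𝟙) k + shift 𝟙 k + 𝟙 k
  lemma : ∀ e → e + 0ℤ + 0ℤ - (0ℤ + 0ℤ + 0ℤ) ≡ e - 0ℤ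
  lemma = solve-∀
  go : ∀ k → shift G k - G k ≡ (q^ 3) k - 𝟙 k
  go zero                = refl
  go (suc zero)          = refl
  go (suc (suc zero))    = refl
  go (suc (suc (suc k))) = lemma (𝟙 k)
segment-closed (suc m) k = trans (cong₂ _-_ (shift-cong (segment-suc m) k) (segment-suc m k))
  (trans (go k) (cong (λ e → (q^ (3 ℕ.+ e)) k - 𝟙 k) (sym (ℕ.*-suc 2 m))))
  where
  G : Series
  G k = shift (segment m) k + 𝟙 k + (q^ (4 ℕ.+ 2 ℕ.* m)) k
  lemma : ∀ a b e p q → a + e + q - (b + 0ℤ + p) ≡ a - b + e + q - p
  lemma = solve-∀
  lemma′ : ∀ p q e → p - e + e + q - p ≡ q - 0ℤ
  lemma′ = solve-∀
  go : ∀ k → shift G k - G k ≡ (q^ (5 ℕ.+ 2 ℕ.* m)) k - 𝟙 k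
  go zero    = refl
  go (suc k) = trans (lemma (shift (segment m) k) (segment m k) (𝟙 k) p q)
    (trans (cong (λ z → z + 𝟙 k + q - p) (segment-closed m k)) (lemma′ p q (𝟙 k)))
    where
    p = (q^ (3 ℕ.+ 2 ℕ.* m)) k
    q = (q^ (4 ℕ.+ 2 ℕ.* m)) k

-- The denominator is multiplied out; q² - 1 is invertible in ℤ[[q]], so this still determines `F`.
-- The exponent comes with an equation because the theorem writes it with truncated subtraction.
sym²-formula : ∀ m {F e} → F ≗ sym² (suc m) → e ≡ 2 ℕ.+ 2 ℕ.* m →
  (q^ 2 ⊖ 𝟙) ⊛ F ≗ q^ 2 ⊛ (q^ e ⊖ 𝟙)
sym²-formula m {F} {e} eq refl k = begin
  ((q^ 2 ⊖ 𝟙) ⊛ F) k                     ≡⟨ ⊛-congʳ (q^ 2 ⊖ 𝟙) eq k ⟩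
  ((q^ 2 ⊖ 𝟙) ⊛ S) k                     ≡⟨ ⊛-distribʳ-⊖ (q^ 2) 𝟙 S k ⟩
  (q^ 2 ⊛ S) k - (𝟙 ⊛ S) k               ≡⟨ cong₂ _-_ (q²-⊛ S k) (𝟙-⊛ S k) ⟩
  shift (shift S) k - S k                ≡⟨ sym²-closed (suc m) k ⟩
  shift (shift (q^ (2 ℕ.* suc m) ⊖ 𝟙)) k ≡⟨ cong (λ e → shift (shift (q^ e ⊖ 𝟙)) k) (ℕ.*-suc 2 m) ⟩
  shift (shift (q^ e ⊖ 𝟙)) k             ≡⟨ q²-⊛ (q^ e ⊖ 𝟙) k ⟨
  (q^ 2 ⊛ (q^ e ⊖ 𝟙)) k                  ∎
  where
  open ≡-Reasoning
  S = sym² (suc m)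

vector²-segment : ∀ m → vector² m ⊖ q^ suc (suc m) ≗ shift (segment m)
vector²-segment m zero    = refl
vector²-segment m (suc k) = refl

vector²-formula : ∀ m {F e} → F ≗ vector² m → e ≡ 3 ℕ.+ 2 ℕ.* m →
  (q^ 1 ⊖ 𝟙) ⊛ (F ⊖ q^ suc (suc m)) ≗ q^ 1 ⊛ (q^ e ⊖ 𝟙)
vector²-formula m {F} {e} eq refl k = begin
  ((q^ 1 ⊖ 𝟙) ⊛ (F ⊖ q^ suc (suc m))) k
    ≡⟨ ⊛-congʳ (q^ 1 ⊖ 𝟙) (λ k → trans (cong (λ z → z - (q^ suc (suc m)) k) (eq k)) (vector²-segment m k)) k ⟩
  ((q^ 1 ⊖ 𝟙) ⊛ shift G) k
    ≡⟨ trans (⊛-distribʳ-⊖ (q^ 1) 𝟙 (shift G) k) (cong₂ _-_ (q¹-⊛ (shift G) k) (𝟙-⊛ (shift G) k)) ⟩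
  shift (shift G) k - shift G k
    ≡⟨ go k ⟩
  shift (q^ e ⊖ 𝟙) k
    ≡⟨ q¹-⊛ (q^ e ⊖ 𝟙) k ⟨
  (q^ 1 ⊛ (q^ e ⊖ 𝟙)) k ∎
  where
  open ≡-Reasoning
  G = segment m
  go : ∀ k → shift (shift G) k - shift G k ≡ shift (q^ e ⊖ 𝟙) k
  go zero    = refl
  go (suc k) = segment-closed m k

-- As q² - 1 = (q + 1)(q - 1), the segment contributes q(q + 1)(q^(2m+3) - 1). Removing q^(2m+4) -
-- q² for `sym²` leaves q^(2m+5) - q.
ext²-formula : ∀ m {F e} → F ≗ vector² m ⊖ sym² (suc m) → e ≡ 4 ℕ.+ 2 ℕ.* m →
  (q^ 2 ⊖ 𝟙) ⊛ (F ⊖ q^ suc (suc m)) ≗ q^ 1 ⊛ (q^ e ⊖ 𝟙)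
ext²-formula m {F} {e} eq refl k = begin
  ((q^ 2 ⊖ 𝟙) ⊛ (F ⊖ q^ suc (suc m))) k
    ≡⟨ ⊛-congʳ (q^ 2 ⊖ 𝟙) (λ k → trans (cong (λ z → z - (q^ suc (suc m)) k) (eq k))
        (trans (exchange (vector² m k) (S k) ((q^ suc (suc m)) k)) (cong (λ z → z - S k) (vector²-segment m k)))) k ⟩
  ((q^ 2 ⊖ 𝟙) ⊛ X) k
    ≡⟨ trans (⊛-distribʳ-⊖ (q^ 2) 𝟙 X k) (cong₂ _-_ (q²-⊛ X k) (𝟙-⊛ X k)) ⟩
  shift (shift X) k - X k
    ≡⟨ go k ⟩
  shift (q^ e ⊖ 𝟙) k
    ≡⟨ q¹-⊛ (q^ e ⊖ 𝟙) k ⟨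
  (q^ 1 ⊛ (q^ e ⊖ 𝟙)) k ∎
  where
  open ≡-Reasoning
  G = segment m
  S = sym² (suc m)
  X = shift G ⊖ S
  exchange : ∀ a b c → a - b - c ≡ a - c - b
  exchange = solve-∀
  lemma₁ : ∀ g → 0ℤ - (g - 0ℤ) ≡ 0ℤ - g
  lemma₁ = solve-∀
  lemma₂ : ∀ g₀ g₁ g₂ s₀ s₂ → g₀ - s₀ - (g₂ - s₂) ≡ g₀ - g₁ + (g₁ - g₂) - (s₀ - s₂)
  lemma₂ = solve-∀
  lemma₃ : ∀ p q e → p - e + (q - 0ℤ) - (q - e) ≡ p - 0ℤ
  lemma₃ = solve-∀
  closed : ∀ k → S k - S (suc (suc k)) ≡ (q^ (2 ℕ.+ 2 ℕ.* m)) k - 𝟙 k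
  closed k = trans (sym²-closed (suc m) (suc (suc k))) (cong (λ e → (q^ e) k - 𝟙 k) (ℕ.*-suc 2 m))
  go : ∀ k → shift (shift X) k - X k ≡ shift (q^ e ⊖ 𝟙) k
  go zero          = refl
  go (suc zero)    = trans (lemma₁ (G 0)) (segment-closed m 0)
  -- The factor q + 1: a difference over two degrees is split at `G k` into two differences over
  -- one.
  go (suc (suc k)) = trans (lemma₂ (shift G k) (G k) (G (suc k)) (S k) (S (suc (suc k))))
    (trans (cong₂ _-_ (cong₂ _+_ (segment-closed m k) (segment-closed m (suc k))) (closed k))
      (lemma₃ ((q^ (3 ℕ.+ 2 ℕ.* m)) k) ((q^ (2 ℕ.+ 2 ℕ.* m)) k) (𝟙 k)))

-- The individual entries

weight⊞ρ : ∀ n → weight n [] ⊞ ρ n ≡ staircase n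
weight⊞ρ zero    = refl
weight⊞ρ (suc n) = cong (+ n ∷_) (weight⊞ρ n)

K≗D-weights : ∀ {n} lam mu {x y : Weight n} → weight n lam ⊞ ρ n ≡ x → weight n mu ⊞ ρ n ≡ y →
  K (weight n lam) (weight n mu) ≗ D x y
K≗D-weights {n} lam mu refl refl = K≗D (weight n lam) (weight n mu)

weight⊞ρ₁ : ∀ a n → weight (suc n) (a ∷ []) ⊞ ρ (suc n) ≡ + (a ℕ.+ n) ∷ staircase n
weight⊞ρ₁ a n = cong (+ (a ℕ.+ n) ∷_) (weight⊞ρ n)

weight⊞ρ₂ : ∀ a b n → weight (suc (suc n)) (a ∷ b ∷ []) ⊞ ρ (suc (suc n)) ≡
  + (a ℕ.+ suc n) ∷ + (b ℕ.+ n) ∷ staircase n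
weight⊞ρ₂ a b n = cong (+ (a ℕ.+ suc n) ∷_) (weight⊞ρ₁ b n)

weight⊞ρ₃ : ∀ a b c n → weight (suc (suc (suc n))) (a ∷ b ∷ c ∷ []) ⊞ ρ (suc (suc (suc n))) ≡
  + (a ℕ.+ suc (suc n)) ∷ + (b ℕ.+ suc n) ∷ + (c ℕ.+ n) ∷ staircase n
weight⊞ρ₃ a b c n = cong (+ (a ℕ.+ suc (suc n)) ∷_) (weight⊞ρ₂ b c n)

K₍₂₎,₍₂₎ : ∀ m → K (weight (suc (suc m)) (2 ∷ [])) (weight (suc (suc m)) (2 ∷ [])) ≗ 𝟙
K₍₂₎,₍₂₎ m k = trans (K≗D-weights (2 ∷ []) (2 ∷ []) (weight⊞ρ₁ 2 (suc m)) (weight⊞ρ₁ 2 (suc m)) k)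
  (trans (D-peel (suc (suc m)) (below-staircase (s≤s (ℕ.≤-trans (ℕ.n≤1+n m) (ℕ.n≤1+n (suc m))))) (staircase (suc m)) k)
    (D-staircase (suc m) k))

K₍₂₎,₍₁₁₎ : ∀ m → K (weight (suc (suc m)) (2 ∷ [])) (weight (suc (suc m)) (1 ∷ 1 ∷ [])) ≗ q^ 1
K₍₂₎,₍₁₁₎ m k = trans (K≗D-weights (2 ∷ []) (1 ∷ 1 ∷ []) (weight⊞ρ₁ 2 (suc m)) (weight⊞ρ₂ 1 1 m) k)
  (trans (D-first 1 (suc m) (below-staircase (ℕ.n≤1+n (suc m))) (+ suc m ∷ staircase m) k)
    (trans (level-1 (staircase (suc m)) (+ suc m ∷ staircase m) k) (trans (shift-cong (translate m) k) (shift-𝟙 k))))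
  where
  lemma : ∀ z → z + 0ℤ + (0ℤ + 0ℤ) + 0ℤ ≡ z
  lemma = solve-∀
  translate : ∀ m k → T 1ℤ (λ z → D z (+ suc m ∷ staircase m) k) (staircase (suc m)) ≡ 𝟙 k
  -- In rank 1 the translate -1 would need a sign change to reach 1, and W contains none there.
  translate zero    k = lemma (𝟙 k)
  translate (suc m) k = trans (T₁-staircase m (D-alternating (+ suc (suc m) ∷ staircase (suc m)) k) Sign.+)
    (trans (D-peel (suc m) (below-staircase (ℕ.n≤1+n (suc m))) (staircase (suc m)) k) (D-staircase (suc m) k))
  shift-𝟙 : ∀ k → shift 𝟙 k ≡ (q^ 1) k
  shift-𝟙 zero    = refl
  shift-𝟙 (suc k) = refl

K₍₁₁₎,₍₂₎ : ∀ m → K (weight (suc (suc m)) (1 ∷ 1 ∷ [])) (weight (suc (suc m)) (2 ∷ [])) ≗ 𝟘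
K₍₁₁₎,₍₂₎ m k = trans (K≗D-weights (1 ∷ 1 ∷ []) (2 ∷ []) (weight⊞ρ₂ 1 1 m) (weight⊞ρ₁ 2 (suc m)) k)
  (D-below (suc (suc (suc m))) (ℕ.≤-refl ∷ ℕ.n≤1+n (suc (suc m)) ∷ below-staircase (ℕ.m≤n+m m 3)) (staircase (suc m)) k)

K₍₁₁₎,₍₁₁₎ : ∀ m → K (weight (suc (suc m)) (1 ∷ 1 ∷ [])) (weight (suc (suc m)) (1 ∷ 1 ∷ [])) ≗ 𝟙
K₍₁₁₎,₍₁₁₎ m k = trans (K≗D-weights (1 ∷ 1 ∷ []) (1 ∷ 1 ∷ []) (weight⊞ρ₂ 1 1 m) (weight⊞ρ₂ 1 1 m) k)
  (trans (D-peel (suc m) (ℕ.≤-refl ∷ below-staircase (ℕ.m≤n+m m 2)) (+ suc m ∷ staircase m) k)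
    (trans (D-peel m (below-staircase (ℕ.n≤1+n m)) (staircase m) k) (D-staircase m k)))

K₍₂₎,∅ : ∀ m → K (weight (suc (suc m)) (2 ∷ [])) (weight (suc (suc m)) []) ≗ sym² (suc m)
K₍₂₎,∅ m k = trans (K≗D-weights (2 ∷ []) [] (weight⊞ρ₁ 2 (suc m)) (weight⊞ρ (suc (suc m))) k) (D-sym² (suc m) k)

K₍₃₎,₍₁₎ : ∀ m → K (weight (suc (suc m)) (3 ∷ [])) (weight (suc (suc m)) (1 ∷ [])) ≗ sym² (suc m)
K₍₃₎,₍₁₎ m k = trans (K≗D-weights (3 ∷ []) (1 ∷ []) (weight⊞ρ₁ 3 (suc m)) (weight⊞ρ₁ 1 (suc m)) k)
  (D-level-2 m (half-level-2-staircase m) (ℕ.n≤1+n m) k)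

-- The rank starts at 3: in rank 2 the entry is `q`, whereas the closed form would give 2q, the
-- second `q` belonging to the weight (1,-1).
K₍₁₁₎,∅ : ∀ m → K (weight (3 ℕ.+ m) (1 ∷ 1 ∷ [])) (weight (3 ℕ.+ m) []) ≗ vector² m ⊖ sym² (suc m)
K₍₁₁₎,∅ m k = trans (K≗D-weights (1 ∷ 1 ∷ []) [] (weight⊞ρ₂ 1 1 (suc m)) (weight⊞ρ (3 ℕ.+ m)) k) (D-ext²-suc m k)

K₍₂₁₎,₍₁₎ : ∀ m → K (weight (3 ℕ.+ m) (2 ∷ 1 ∷ [])) (weight (3 ℕ.+ m) (1 ∷ [])) ≗ vector² m
K₍₂₁₎,₍₁₎ m k = trans (K≗D-weights (2 ∷ 1 ∷ []) (1 ∷ []) (weight⊞ρ₂ 2 1 (suc m)) (weight⊞ρ₁ 1 (suc (suc m))) k)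
  (trans (D-first 1 (suc (suc m)) (ℕ.≤-refl ∷ below-staircase (ℕ.m≤n+m (suc m) 2)) (staircase (suc (suc m))) k)
    (trans (level-1 (+ suc (suc m) ∷ staircase (suc m)) (staircase (suc (suc m))) k)
      (shift-cong (T₁-vector-staircase m (half-level-2-staircase m)) k)))

K₍₁₁₁₎,₍₁₎ : ∀ m → K (weight (4 ℕ.+ m) (1 ∷ 1 ∷ 1 ∷ [])) (weight (4 ℕ.+ m) (1 ∷ [])) ≗ vector² m ⊖ sym² (suc m)
K₍₁₁₁₎,₍₁₎ m k = trans (K≗D-weights (1 ∷ 1 ∷ 1 ∷ []) (1 ∷ []) (weight⊞ρ₃ 1 1 1 (suc m)) (weight⊞ρ₁ 1 (3 ℕ.+ m)) k)
  (trans (D-peel (3 ℕ.+ m) (ℕ.≤-refl ∷ ℕ.n≤1+n (3 ℕ.+ m) ∷ below-staircase (ℕ.m≤n+m (suc m) 3)) (staircase (3 ℕ.+ m)) k)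
    (D-ext²-suc m k))

mainTheorem8 : ∀ (n : ℕ) → 2 ≤ n →
    let K[_,_] : List ℕ → List ℕ → Series
        K[ lam , mu ] = K (weight n lam) (weight n mu)
    in
      -- λ = (3)
      ( K[ 3 ∷ [] , 2 ∷ [] ] ≗ 𝟘
      × K[ 3 ∷ [] , 1 ∷ 1 ∷ [] ] ≗ 𝟘
      × K[ 3 ∷ [] , [] ] ≗ 𝟘
      × (q^ 2 ⊖ 𝟙) ⊛ K[ 3 ∷ [] , 1 ∷ [] ] ≗ q^ 2 ⊛ (q^ (2 ℕ.* n ∸ 2) ⊖ 𝟙) )
      -- λ = (2,1)
    × ( K[ 2 ∷ 1 ∷ [] , 2 ∷ [] ] ≗ 𝟘
      × K[ 2 ∷ 1 ∷ [] , 1 ∷ 1 ∷ [] ] ≗ 𝟘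
      × K[ 2 ∷ 1 ∷ [] , [] ] ≗ 𝟘
      × (3 ≤ n →
          (q^ 1 ⊖ 𝟙) ⊛ (K[ 2 ∷ 1 ∷ [] , 1 ∷ [] ] ⊖ q^ (n ∸ 1)) ≗ q^ 1 ⊛ (q^ (2 ℕ.* n ∸ 3) ⊖ 𝟙)) )
      -- λ = (1,1,1)
    × ( (3 ≤ n → K[ 1 ∷ 1 ∷ 1 ∷ [] , 2 ∷ [] ] ≗ 𝟘)
      × (3 ≤ n → K[ 1 ∷ 1 ∷ 1 ∷ [] , 1 ∷ 1 ∷ [] ] ≗ 𝟘)
      × (3 ≤ n → K[ 1 ∷ 1 ∷ 1 ∷ [] , [] ] ≗ 𝟘)
      × (4 ≤ n →
          (q^ 2 ⊖ 𝟙) ⊛ (K[ 1 ∷ 1 ∷ 1 ∷ [] , 1 ∷ [] ] ⊖ q^ (n ∸ 2)) ≗ q^ 1 ⊛ (q^ (2 ℕ.* n ∸ 4) ⊖ 𝟙)) )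
      -- λ = (2)
    × ( K[ 2 ∷ [] , 2 ∷ [] ] ≗ 𝟙
      × K[ 2 ∷ [] , 1 ∷ 1 ∷ [] ] ≗ q^ 1
      × K[ 2 ∷ [] , 1 ∷ [] ] ≗ 𝟘
      × (q^ 2 ⊖ 𝟙) ⊛ K[ 2 ∷ [] , [] ] ≗ q^ 2 ⊛ (q^ (2 ℕ.* n ∸ 2) ⊖ 𝟙) )
      -- λ = (1,1)
    × ( K[ 1 ∷ 1 ∷ [] , 2 ∷ [] ] ≗ 𝟘
      × K[ 1 ∷ 1 ∷ [] , 1 ∷ 1 ∷ [] ] ≗ 𝟙
      × K[ 1 ∷ 1 ∷ [] , 1 ∷ [] ] ≗ 𝟘
      × (3 ≤ n →
          (q^ 2 ⊖ 𝟙) ⊛ (K[ 1 ∷ 1 ∷ [] , [] ] ⊖ q^ (n ∸ 1)) ≗ q^ 1 ⊛ (q^ (2 ℕ.* n ∸ 2) ⊖ 𝟙)) )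
mainTheorem8 n@(suc (suc m)) (s≤s (s≤s z≤n)) =
    ( odd (3 ∷ []) (2 ∷ []) odd-1 1≤n 1≤n
    , odd (3 ∷ []) (1 ∷ 1 ∷ []) odd-1 1≤n 2≤n
    , odd (3 ∷ []) [] odd-3 1≤n z≤n
    , sym²-formula m (K₍₃₎,₍₁₎ m) exponent )
  , ( odd (2 ∷ 1 ∷ []) (2 ∷ []) odd-1 2≤n 1≤n
    , odd (2 ∷ 1 ∷ []) (1 ∷ 1 ∷ []) odd-1 2≤n 2≤n
    , odd (2 ∷ 1 ∷ []) [] odd-3 2≤n z≤n
    , formula₍₂₁₎,₍₁₎ m )
  , ( (λ 3≤n → odd (1 ∷ 1 ∷ 1 ∷ []) (2 ∷ []) odd-1 3≤n 1≤n)
    , (λ 3≤n → odd (1 ∷ 1 ∷ 1 ∷ []) (1 ∷ 1 ∷ []) odd-1 3≤n 2≤n)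
    , (λ 3≤n → odd (1 ∷ 1 ∷ 1 ∷ []) [] odd-3 3≤n z≤n)
    , formula₍₁₁₁₎,₍₁₎ m )
  , ( K₍₂₎,₍₂₎ m
    , K₍₂₎,₍₁₁₎ m
    , odd (2 ∷ []) (1 ∷ []) odd-1 1≤n 1≤n
    , sym²-formula m (K₍₂₎,∅ m) exponent )
  , ( K₍₁₁₎,₍₂₎ m
    , K₍₁₁₎,₍₁₁₎ m
    , odd (1 ∷ 1 ∷ []) (1 ∷ []) odd-1 2≤n 1≤n
    , formula₍₁₁₎,∅ m )
  where
  1≤n : 1 ≤ n
  1≤n = s≤s z≤n
  2≤n : 2 ≤ n
  2≤n = s≤s (s≤s z≤n)
  odd-1 : ¬ Even (+ 1)
  odd-1 = from-no (+ 2 ∣? + 1)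
  odd-3 : ¬ Even (+ 3)
  odd-3 = from-no (+ 2 ∣? + 3)
  odd : ∀ as bs → ¬ Even (+ sum as - + sum bs) → length as ≤ n → length bs ≤ n → K (weight n as) (weight n bs) ≗ 𝟘
  odd = K-odd-weight
  exponent : 2 ℕ.* n ∸ 2 ≡ 2 ℕ.+ 2 ℕ.* m
  exponent = cong (_∸ 2) (ℕ.*-distribˡ-+ 2 2 m)
  formula₍₂₁₎,₍₁₎ : ∀ m → 3 ≤ suc (suc m) →
    (q^ 1 ⊖ 𝟙) ⊛ (K (weight (suc (suc m)) (2 ∷ 1 ∷ [])) (weight (suc (suc m)) (1 ∷ [])) ⊖ q^ suc m) ≗
    q^ 1 ⊛ (q^ (2 ℕ.* suc (suc m) ∸ 3) ⊖ 𝟙)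
  formula₍₂₁₎,₍₁₎ (suc m) _ = vector²-formula m (K₍₂₁₎,₍₁₎ m) (cong (_∸ 3) (ℕ.*-distribˡ-+ 2 3 m))
  formula₍₂₁₎,₍₁₎ zero    (s≤s (s≤s ()))
  formula₍₁₁₎,∅ : ∀ m → 3 ≤ suc (suc m) →
    (q^ 2 ⊖ 𝟙) ⊛ (K (weight (suc (suc m)) (1 ∷ 1 ∷ [])) (weight (suc (suc m)) []) ⊖ q^ suc m) ≗
    q^ 1 ⊛ (q^ (2 ℕ.* suc (suc m) ∸ 2) ⊖ 𝟙)
  formula₍₁₁₎,∅ (suc m) _ = ext²-formula m (K₍₁₁₎,∅ m) (cong (_∸ 2) (ℕ.*-distribˡ-+ 2 3 m))
  formula₍₁₁₎,∅ zero    (s≤s (s≤s ()))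
  formula₍₁₁₁₎,₍₁₎ : ∀ m → 4 ≤ suc (suc m) →
    (q^ 2 ⊖ 𝟙) ⊛ (K (weight (suc (suc m)) (1 ∷ 1 ∷ 1 ∷ [])) (weight (suc (suc m)) (1 ∷ [])) ⊖ q^ m) ≗
    q^ 1 ⊛ (q^ (2 ℕ.* suc (suc m) ∸ 4) ⊖ 𝟙)
  formula₍₁₁₁₎,₍₁₎ (suc (suc m)) _ = ext²-formula m (K₍₁₁₁₎,₍₁₎ m) (cong (_∸ 4) (ℕ.*-distribˡ-+ 2 4 m))
  formula₍₁₁₁₎,₍₁₎ (suc zero)    (s≤s (s≤s (s≤s ())))
  formula₍₁₁₁₎,₍₁₎ zero          (s≤s (s≤s ()))
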